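{- Let $G$ be a connected weighted graph with a cluster $(C,S)$, $|C|=c$, $|S|=s$, let $H$ be a weighted graph with vertex set $C$ such that $\mathbf{1}_c$ is an eigenvector of $M(H)$, and let $G(H)$ be the graph obtained from $G$ by adding the edges of $H$ on $C$. Let $\mathbf{x}\in\mathbb{R}^c$ satisfy $\mathbf{1}_c^T\mathbf{x}=0$. Then for all $t\in\mathbb{R}$, $$U_{G(H)}(t)\begin{bmatrix}\mathbf{x}\\ \mathbf{0}\end{bmatrix}=e^{i\delta t\,\mathbf{1}_s^T\mathbf{z}}\begin{bmatrix}U_H(t)\mathbf{x}\\ \mathbf{0}\end{bmatrix},$$ where $\mathbf{z}\in\mathbb{R}^s$ has components $\mathbf{z}(v)=\omega(u,v)$ for $v\in S$ (and any $u\in C$), and $\delta=0$ if $M=A$, $\delta=1$ if $M\in\{L,Q\}$.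
   Context: A weighted graph has positive edge weights; its adjacency matrix $A$ has $A_{ij}$ equal to the weight of edge $ij$ (0 if no edge), $\Delta$ is the diagonal matrix of row sums of $A$, $L=\Delta-A$, $Q=\Delta+A$. $M$ denotes any one of $A,L,Q$ (same choice for all graphs), and $U_X(t)=\exp(itM(X))$. Cluster: for $C,S\subseteq V(G)$ with $|C|\ge2$, the pair $(C,S)$ is a cluster in $G$ if the vertices of $C$ are pairwise non-adjacent, the neighbourhood of each $a\in C$ in $G$ is equal to $S$, and for each $v\in S$ the edge weight $\omega(u,v)$ is the same for all $u\in C$. $G(H)$ has vertex set $V(G)$ and edge set $E(G)\cup E(H)$, with edge weights from $G$ and $H$ preserved; its vertices are ordered with those of $C$ first. $\mathbf{1}_k$ is the all-ones vector of length $k$. -}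

module Defs where

open import Level using (0ℓ)
import Algebra.Consequences.Setoid
open import Algebra.Bundles using (CommutativeRing)
open import Data.Bool.Base using (true; false; if_then_else_)
open import Data.Fin.Base using (Fin; zero; suc; splitAt)
import Data.Fin.Properties as Fin
import Data.Integer.Base as ℤ
import Data.Integer.Properties as ℤ
open import Data.Nat.Base as ℕ using (ℕ; zero; suc; _!; z≤n; s≤s)
import Data.Nat.Properties as ℕ
import Data.Nat.Solver as ℕ-Solver
open import Data.Product.Base using (Σ; Σ-syntax; ∃-syntax; _×_; _,_; proj₁; proj₂)
open import Data.Rational.Base as ℚ using (ℚ; 0ℚ; 1ℚ; ½)
import Data.Rational.Properties as ℚ
open import Data.Rational.Solver using (module +-*-Solver)
import Data.Rational.Unnormalised.Base as ℚᵘ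
import Data.Rational.Unnormalised.Properties as ℚᵘ
open import Data.Sum.Base as Sum using (_⊎_; inj₁; inj₂)
open import Data.Vec.Base as Vec using (_∷_)
open import Data.Vec.Functional using (Vector)
open import Function.Base using (_∘_)
open import Function.Bundles using (_⇔_)
open import Relation.Binary.Construct.Closure.ReflexiveTransitive using (Star)
open import Relation.Binary.Bundles using (Setoid)
open import Relation.Binary.Core using (Rel)
open import Relation.Binary.Definitions
  using (Decidable; Irreflexive; Symmetric)
open import Relation.Binary.PropositionalEquality
  using (_≡_; refl; sym; trans; cong; cong₂; subst; subst₂)
open import Relation.Nullary using (¬_; yes; no; does; contradiction)
open import Relation.Nullary.Decidable.Core using (_⊎-dec_; map′)

module _ where
  open import Data.Rational.Base hiding (ℚ; 0ℚ; 1ℚ; ½)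

  0<½* : ∀ {ε} → 0ℚ < ε → 0ℚ < ½ * ε
  0<½* {ε} 0<ε = subst (_< ½ * ε) (ℚ.*-zeroʳ ½) (ℚ.*-monoʳ-<-pos ½ 0<ε)

  halves : ∀ ε → ½ * ε + ½ * ε ≡ ε
  halves = solve 1 (λ e → con ½ :* e :+ con ½ :* e := e) refl
    where open +-*-Solver

  divide : ∀ {K ε} → 0ℚ < K → 0ℚ < ε → Σ[ δ ∈ ℚ ] 0ℚ < δ × K * δ ≡ ε
  divide {K} {ε} 0<K 0<ε = 1/K * ε , 0<δ , eq
    where
    instance
      K-pos : Positive K
      K-pos = ℚ.positive 0<K
      K-nonZero : NonZero K
      K-nonZero = ℚ.pos⇒nonZero K
    1/K : ℚ
    1/K = 1/ K
    instance
      1/K-pos : Positive 1/K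
      1/K-pos = ℚ.1/pos⇒pos K
    0<δ : 0ℚ < 1/K * ε
    0<δ = subst (_< 1/K * ε) (ℚ.*-zeroʳ 1/K) (ℚ.*-monoʳ-<-pos 1/K 0<ε)
    eq : K * (1/K * ε) ≡ ε
    eq = trans (sym (ℚ.*-assoc K 1/K ε))
         (trans (cong (_* ε) (ℚ.*-inverseʳ K)) (ℚ.*-identityˡ ε))

  *-mono-≤ : ∀ {p q r s} → 0ℚ ≤ p → 0ℚ ≤ s → p ≤ q → r ≤ s → p * r ≤ q * s
  *-mono-≤ {p} {q} {r} {s} 0≤p 0≤s p≤q r≤s =
    ℚ.≤-trans (ℚ.*-monoˡ-≤-nonNeg p {{nonNegative 0≤p}} r≤s)
              (ℚ.*-monoʳ-≤-nonNeg s {{nonNegative 0≤s}} p≤q)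

  Near : ℚ → Rel ℚ 0ℓ
  Near ε x y = ∣ x - y ∣ ≤ ε

  near-refl : ∀ {ε x} → 0ℚ < ε → Near ε x x
  near-refl {ε} {x} 0<ε =
    subst (_≤ ε) (sym (cong ∣_∣ (ℚ.+-inverseʳ x))) (ℚ.<⇒≤ 0<ε)

  near-sym : ∀ {ε x y} → Near ε x y → Near ε y x
  near-sym {ε} {x} {y} h = subst (_≤ ε) (trans (sym (ℚ.∣-p∣≡∣p∣ (x - y)))
    (cong ∣_∣ (solve 2 (λ x y → :- (x :- y) := y :- x) refl x y))) h
    where open +-*-Solver

  near-trans : ∀ {p q x y z} → Near p x y → Near q y z → Near (p + q) x z
  near-trans {p} {q} {x} {y} {z} h k = ℚ.≤-trans
    (subst (λ w → ∣ w ∣ ≤ ∣ x - y ∣ + ∣ y - z ∣)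
      (solve 3 (λ x y z → (x :- y) :+ (y :- z) := x :- z) refl x y z)
      (ℚ.∣p+q∣≤∣p∣+∣q∣ (x - y) (y - z)))
    (ℚ.+-mono-≤ h k)
    where open +-*-Solver

  near-+ : ∀ {p q x y z w} → Near p x y → Near q z w → Near (p + q) (x + z) (y + w)
  near-+ {p} {q} {x} {y} {z} {w} h k = ℚ.≤-trans
    (subst (λ u → ∣ u ∣ ≤ ∣ x - y ∣ + ∣ z - w ∣)
      (solve 4 (λ x y z w → (x :- y) :+ (z :- w) := (x :+ z) :- (y :+ w)) refl x y z w)
      (ℚ.∣p+q∣≤∣p∣+∣q∣ (x - y) (z - w)))
    (ℚ.+-mono-≤ h k)
    where open +-*-Solver

  near-neg : ∀ {p x y} → Near p x y → Near p (- x) (- y)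
  near-neg {p} {x} {y} h = subst (λ u → ∣ u ∣ ≤ p)
    (solve 2 (λ x y → y :- x := (:- x) :- (:- y)) refl x y) (near-sym {x = x} {y} h)
    where open +-*-Solver

  near-∣∣ : ∀ {p x y} → Near p x y → Near p ∣ x ∣ ∣ y ∣
  near-∣∣ {p} {x} {y} h with ℚ.∣p∣≡p∨∣p∣≡-p (∣ x ∣ - ∣ y ∣)
  ... | inj₁ e = subst (_≤ p) (sym e) (ℚ.≤-trans (lower x y) h)
    where
    open +-*-Solver
    lower : ∀ x y → ∣ x ∣ - ∣ y ∣ ≤ ∣ x - y ∣
    lower x y = subst (∣ x ∣ - ∣ y ∣ ≤_)
      (solve 2 (λ a b → (a :+ b) :- b := a) refl (∣ x - y ∣) (∣ y ∣))
      (ℚ.+-monoˡ-≤ (- ∣ y ∣)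
        (subst (λ u → ∣ u ∣ ≤ ∣ x - y ∣ + ∣ y ∣)
          (solve 2 (λ x y → (x :- y) :+ y := x) refl x y)
          (ℚ.∣p+q∣≤∣p∣+∣q∣ (x - y) y)))
  ... | inj₂ e = subst (_≤ p) (sym e) (ℚ.≤-trans (upper x y) (near-sym {x = x} {y} h))
    where
    open +-*-Solver
    upper : ∀ x y → - (∣ x ∣ - ∣ y ∣) ≤ ∣ y - x ∣
    upper x y = subst (_≤ ∣ y - x ∣)
      (solve 2 (λ a b → b :- a := :- (a :- b)) refl (∣ x ∣) (∣ y ∣))
      (subst (∣ y ∣ - ∣ x ∣ ≤_)
        (solve 2 (λ a b → (a :+ b) :- b := a) refl (∣ y - x ∣) (∣ x ∣))
        (ℚ.+-monoˡ-≤ (- ∣ x ∣)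
          (subst (λ u → ∣ u ∣ ≤ ∣ y - x ∣ + ∣ x ∣)
            (solve 2 (λ x y → (y :- x) :+ x := y) refl x y)
            (ℚ.∣p+q∣≤∣p∣+∣q∣ (y - x) x))))

  near-* : ∀ {K L p q x y z w} → 0ℚ ≤ K → 0ℚ ≤ L →
           ∣ x ∣ ≤ K → ∣ w ∣ ≤ L → Near p x y → Near q z w →
           Near (L * p + K * q) (x * z) (y * w)
  near-* {K} {L} {p} {q} {x} {y} {z} {w} 0≤K 0≤L x≤K w≤L h k = ℚ.≤-trans
    (subst (λ u → ∣ u ∣ ≤ ∣ w * (x - y) ∣ + ∣ x * (z - w) ∣)
      (solve 4 (λ x y z w → w :* (x :- y) :+ x :* (z :- w) := x :* z :- y :* w)
        refl x y z w)
      (ℚ.∣p+q∣≤∣p∣+∣q∣ (w * (x - y)) (x * (z - w))))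
    (ℚ.+-mono-≤
      (subst (_≤ L * p) (sym (ℚ.∣p*q∣≡∣p∣*∣q∣ w (x - y)))
        (*-mono-≤ (ℚ.0≤∣p∣ w) (ℚ.≤-trans (ℚ.0≤∣p∣ (x - y)) h) w≤L h))
      (subst (_≤ K * q) (sym (ℚ.∣p*q∣≡∣p∣*∣q∣ x (z - w)))
        (*-mono-≤ (ℚ.0≤∣p∣ x) (ℚ.≤-trans (ℚ.0≤∣p∣ (z - w)) k) x≤K k)))
    where open +-*-Solver

  opaque
    fromℕ : ℕ → ℚ
    fromℕ n = ℤ.+ n / 1

    recip : (n : ℕ) .{{_ : ℕ.NonZero n}} → ℚ
    recip n = ℤ.+ 1 / n

    0<recip : ∀ n .{{_ : ℕ.NonZero n}} → 0ℚ < recip n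
    0<recip n = ℚ.positive⁻¹ (recip n) {{ℚ.normalize-pos 1 n}}

    fromℕ-1 : fromℕ 1 ≡ 1ℚ
    fromℕ-1 = refl

    fromℕ-0 : fromℕ 0 ≡ 0ℚ
    fromℕ-0 = refl

    recip-1 : recip 1 ≡ 1ℚ
    recip-1 = refl

    frac-≤ : ∀ a b c d .{{_ : ℕ.NonZero b}} .{{_ : ℕ.NonZero d}} →
             a ℕ.* d ℕ.≤ c ℕ.* b →
             fromℕ a * recip b ≤ fromℕ c * recip d
    frac-≤ a (suc b) c (suc d) h = ℚ.toℚᵘ-cancel-≤
      (ℚᵘ.≤-respˡ-≃ (ℚᵘ.≃-sym (lhs a b)) (ℚᵘ.≤-respʳ-≃ (ℚᵘ.≃-sym (lhs c d))
        (ℚᵘ.*≤* (ineq a b c d h))))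
      where
      lhs : ∀ a b → toℚᵘ (fromℕ a * recip (suc b)) ℚᵘ.≃
                    ℚᵘ.mkℚᵘ (ℤ.+ a) 0 ℚᵘ.* ℚᵘ.mkℚᵘ (ℤ.+ 1) b
      lhs a b = ℚᵘ.≃-trans (ℚ.toℚᵘ-homo-* (fromℕ a) (recip (suc b)))
        (ℚᵘ.*-cong (ℚ.toℚᵘ-fromℚᵘ (ℚᵘ.mkℚᵘ (ℤ.+ a) 0))
                   (ℚ.toℚᵘ-fromℚᵘ (ℚᵘ.mkℚᵘ (ℤ.+ 1) b)))
      ineq : ∀ a b c d → a ℕ.* suc d ℕ.≤ c ℕ.* suc b →
             (ℤ.+ a ℤ.* ℤ.+ 1) ℤ.* (ℤ.+ (1 ℕ.* suc d)) ℤ.≤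
             (ℤ.+ c ℤ.* ℤ.+ 1) ℤ.* (ℤ.+ (1 ℕ.* suc b))
      ineq a b c d h
        rewrite ℤ.*-identityʳ (ℤ.+ a) | ℤ.*-identityʳ (ℤ.+ c)
              | ℕ.*-identityˡ (suc d) | ℕ.*-identityˡ (suc b)
              | sym (ℤ.pos-* a (suc d)) | sym (ℤ.pos-* c (suc b)) = ℤ.+≤+ h

    frac-≡ : ∀ a b c d .{{_ : ℕ.NonZero b}} .{{_ : ℕ.NonZero d}} →
             a ℕ.* d ≡ c ℕ.* b →
             fromℕ a * recip b ≡ fromℕ c * recip d
    frac-≡ a b c d h = ℚ.≤-antisym (frac-≤ a b c d (ℕ.≤-reflexive h))
                                   (frac-≤ c d a b (ℕ.≤-reflexive (sym h)))

    fromℕ-mono-≤ : ∀ {m n} → m ℕ.≤ n → fromℕ m ≤ fromℕ n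
    fromℕ-mono-≤ {m} {n} h = subst₂ _≤_ (ℚ.*-identityʳ (fromℕ m)) (ℚ.*-identityʳ (fromℕ n))
      (frac-≤ m 1 n 1 (ℕ.*-monoˡ-≤ 1 h))

    0≤fromℕ : ∀ n → 0ℚ ≤ fromℕ n
    0≤fromℕ n = fromℕ-mono-≤ {0} {n} z≤n

    fromℕ-* : ∀ m n → fromℕ (m ℕ.* n) ≡ fromℕ m * fromℕ n
    fromℕ-* m n = ℚ.toℚᵘ-injective (ℚᵘ.≃-trans (ℚ.toℚᵘ-fromℚᵘ (ℚᵘ.mkℚᵘ (ℤ.+ (m ℕ.* n)) 0))
      (ℚᵘ.≃-sym (ℚᵘ.≃-trans (ℚ.toℚᵘ-homo-* (fromℕ m) (fromℕ n))
        (ℚᵘ.≃-trans (ℚᵘ.*-cong (ℚ.toℚᵘ-fromℚᵘ (ℚᵘ.mkℚᵘ (ℤ.+ m) 0))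
                               (ℚ.toℚᵘ-fromℚᵘ (ℚᵘ.mkℚᵘ (ℤ.+ n) 0)))
          (ℚᵘ.*≡* (cong (ℤ._* ℤ.+ 1) (sym (ℤ.pos-* m n))))))))

    fromℕ-suc : ∀ n → fromℕ (suc n) ≡ 1ℚ + fromℕ n
    fromℕ-suc n = ℚ.toℚᵘ-injective (ℚᵘ.≃-trans (ℚ.toℚᵘ-fromℚᵘ (ℚᵘ.mkℚᵘ (ℤ.+ suc n) 0))
      (ℚᵘ.≃-sym (ℚᵘ.≃-trans (ℚ.toℚᵘ-homo-+ 1ℚ (fromℕ n))
        (ℚᵘ.≃-trans (ℚᵘ.+-congʳ (toℚᵘ 1ℚ) (ℚ.toℚᵘ-fromℚᵘ (ℚᵘ.mkℚᵘ (ℤ.+ n) 0)))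
          (ℚᵘ.*≡* (cong (λ k → (ℤ.+ 1 ℤ.+ k) ℤ.* ℤ.+ 1) (ℤ.*-identityʳ (ℤ.+ n))))))))

    fromℕ-+ : ∀ m n → fromℕ (m ℕ.+ n) ≡ fromℕ m + fromℕ n
    fromℕ-+ zero n = trans (sym (ℚ.+-identityˡ (fromℕ n))) (cong (_+ fromℕ n) (sym fromℕ-0))
    fromℕ-+ (suc m) n = trans (fromℕ-suc (m ℕ.+ n)) (trans (cong (1ℚ +_) (fromℕ-+ m n))
      (trans (sym (ℚ.+-assoc 1ℚ (fromℕ m) (fromℕ n))) (cong (_+ fromℕ n) (sym (fromℕ-suc m)))))

    ≤fromℕ : ∀ p → p ≤ fromℕ ℤ.∣ ↥ p ∣
    ≤fromℕ p = ℚ.toℚᵘ-cancel-≤ (ℚᵘ.≤-respʳ-≃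
      (ℚᵘ.≃-sym (ℚ.toℚᵘ-fromℚᵘ (ℚᵘ.mkℚᵘ (ℤ.+ ℤ.∣ ↥ p ∣) 0))) (bound p))
      where
      bound : ∀ p → toℚᵘ p ℚᵘ.≤ ℚᵘ.mkℚᵘ (ℤ.+ ℤ.∣ ↥ p ∣) 0
      bound (mkℚ (ℤ.+ n) d _) = ℚᵘ.*≤* (ℤ.*-monoˡ-≤-nonNeg (ℤ.+ n) (ℤ.+≤+ (s≤s z≤n)))
      bound (mkℚ ℤ.-[1+ n ] d _) = ℚᵘ.*≤* ℤ.-≤+

  unit : ℕ → ℚ
  unit n = recip (suc n)

  0<fromℕ : ∀ n → 0ℚ < fromℕ (suc n)
  0<fromℕ n = ℚ.<-≤-trans (ℚ.positive⁻¹ 1ℚ)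
    (subst (_≤ fromℕ (suc n)) fromℕ-1 (fromℕ-mono-≤ {1} {suc n} (s≤s z≤n)))

  0<unit : ∀ n → 0ℚ < unit n
  0<unit n = 0<recip (suc n)

  unit-antitone : ∀ {m n} → m ℕ.≤ n → unit n ≤ unit m
  unit-antitone {m} {n} h = subst₂ _≤_ (ℚ.*-identityˡ (unit n)) (ℚ.*-identityˡ (unit m))
    (subst₂ _≤_ (cong (_* unit n) fromℕ-1) (cong (_* unit m) fromℕ-1) (frac-≤ 1 (suc n) 1 (suc m) (ℕ.+-monoˡ-≤ 0 (s≤s h))))

  unit-≤ : ∀ ε → 0ℚ < ε → ∃[ n ] unit n ≤ ε
  unit-≤ ε 0<ε = n , h
    where
    d : Σ[ δ ∈ ℚ ] 0ℚ < δ × ε * δ ≡ 1ℚ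
    d = divide 0<ε (ℚ.positive⁻¹ 1ℚ)
    δ : ℚ
    δ = proj₁ d
    n : ℕ
    n = ℤ.∣ ↥ δ ∣
    δ≤ : δ ≤ fromℕ (suc n)
    δ≤ = ℚ.≤-trans (≤fromℕ δ) (fromℕ-mono-≤ (ℕ.n≤1+n n))
    1≤ : 1ℚ ≤ ε * fromℕ (suc n)
    1≤ = subst (_≤ ε * fromℕ (suc n)) (proj₂ (proj₂ d))
      (ℚ.*-monoˡ-≤-nonNeg ε {{nonNegative (ℚ.<⇒≤ 0<ε)}} δ≤)
    cancel : fromℕ (suc n) * unit n ≡ 1ℚ
    cancel = trans (frac-≡ (suc n) (suc n) 1 1 (ℕ.*-comm (suc n) 1))
      (trans (cong₂ _*_ fromℕ-1 recip-1) refl)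
    h : unit n ≤ ε
    h = subst₂ _≤_ (ℚ.*-identityˡ (unit n))
      (trans (ℚ.*-assoc ε (fromℕ (suc n)) (unit n))
        (trans (cong (ε *_) cancel) (ℚ.*-identityʳ ε)))
      (ℚ.*-monoʳ-≤-nonNeg (unit n) {{nonNegative (ℚ.<⇒≤ (0<unit n))}} 1≤)

Eventually : (ℕ → Set) → Set
Eventually P = ∃[ N ] (∀ n → N ℕ.≤ n → P n)

both : ∀ {P Q R : ℕ → Set} → (∀ n → P n → Q n → R n) →
       Eventually P → Eventually Q → Eventually R
both f (M , p) (N , q) = M ℕ.⊔ N , λ n h →
  f n (p n (ℕ.m⊔n≤o⇒m≤o M N h)) (q n (ℕ.m⊔n≤o⇒n≤o M N h))

eventually-map : ∀ {P Q : ℕ → Set} → (∀ n → P n → Q n) → Eventually P → Eventually Q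
eventually-map f (N , p) = N , λ n h → f n (p n h)

Cauchyℚ : (ℕ → ℚ) → Set
Cauchyℚ x = ∀ ε → 0ℚ ℚ.< ε →
  ∃[ N ] (∀ m n → N ℕ.≤ m → N ℕ.≤ n → ℚ.∣ x m ℚ.- x n ∣ ℚ.≤ ε)

record ℝ : Set where
  no-eta-equality
  constructor mkℝ
  field
    approx : ℕ → ℚ
    cauchy : Cauchyℚ approx

open ℝ public

infix 4 _≃_ _≤ᴿ_ _<ᴿ_

-- These are records, rather than functions, so that x and y can be inferred.
record _≃_ (x y : ℝ) : Set where
  constructor mk≃
  field
    close : ∀ ε → 0ℚ ℚ.< ε → Eventually λ n → ℚ.∣ approx x n ℚ.- approx y n ∣ ℚ.≤ ε

record _≤ᴿ_ (x y : ℝ) : Set where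
  constructor mk≤
  field
    below : ∀ ε → 0ℚ ℚ.< ε → Eventually λ n → approx x n ℚ.≤ approx y n ℚ.+ ε

open _≃_ public
open _≤ᴿ_ public

_<ᴿ_ : Rel ℝ 0ℓ
x <ᴿ y = Σ[ ε ∈ ℚ ] 0ℚ ℚ.< ε × Eventually λ n → approx x n ℚ.+ ε ℚ.≤ approx y n

-- For a nonnegative rational q this bounds the absolute value of x by q; it is
-- not invariant under _≃_.
Bounded : ℝ → ℚ → Set
Bounded x q = Eventually λ n → ℚ.∣ approx x n ∣ ℚ.≤ q

bounded⇒0≤ : ∀ {x q} → Bounded x q → 0ℚ ℚ.≤ q
bounded⇒0≤ {x} (N , h) = ℚ.≤-trans (ℚ.0≤∣p∣ (approx x N)) (h N ℕ.≤-refl)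

bounded-weaken : ∀ {x p q} → p ℚ.≤ q → Bounded x p → Bounded x q
bounded-weaken p≤q = eventually-map λ _ h → ℚ.≤-trans h p≤q

bound : ∀ x → Σ[ k ∈ ℕ ] Bounded x (fromℕ k)
bound x = ℤ.∣ ℚ.↥ q ∣ , N , λ n N≤n → ℚ.≤-trans (step n (proj₂ c n N N≤n ℕ.≤-refl)) (≤fromℕ q)
  where
  open +-*-Solver
  c : ∃[ N ] (∀ m n → N ℕ.≤ m → N ℕ.≤ n → ℚ.∣ approx x m ℚ.- approx x n ∣ ℚ.≤ 1ℚ)
  c = cauchy x 1ℚ (ℚ.positive⁻¹ 1ℚ)
  N : ℕ
  N = proj₁ c
  q : ℚ
  q = 1ℚ ℚ.+ ℚ.∣ approx x N ∣
  step : ∀ n → ℚ.∣ approx x n ℚ.- approx x N ∣ ℚ.≤ 1ℚ → ℚ.∣ approx x n ∣ ℚ.≤ q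
  step n h = ℚ.≤-trans
    (subst (λ u → ℚ.∣ u ∣ ℚ.≤ ℚ.∣ approx x n ℚ.- approx x N ∣ ℚ.+ ℚ.∣ approx x N ∣)
      (solve 2 (λ a b → (a :- b) :+ b := a) refl (approx x n) (approx x N))
      (ℚ.∣p+q∣≤∣p∣+∣q∣ (approx x n ℚ.- approx x N) (approx x N)))
    (ℚ.+-monoˡ-≤ ℚ.∣ approx x N ∣ h)

bound⁺ : ∀ x → Σ[ k ∈ ℕ ] Bounded x (fromℕ (suc k))
bound⁺ x = let k , h = bound x in k , bounded-weaken {x} (fromℕ-mono-≤ (ℕ.n≤1+n k)) h

fromℚ : ℚ → ℝ
fromℚ q = mkℝ (λ _ → q) λ ε 0<ε → 0 , λ _ _ _ _ → near-refl {x = q} 0<ε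

0ᴿ 1ᴿ : ℝ
0ᴿ = fromℚ 0ℚ
1ᴿ = fromℚ 1ℚ

infixl 6 _+ᴿ_ _-ᴿ_
infixl 7 _*ᴿ_
infix 8 -ᴿ_

_+ᴿ_ : ℝ → ℝ → ℝ
approx (x +ᴿ y) n = approx x n ℚ.+ approx y n
cauchy (x +ᴿ y) ε 0<ε =
  let M , p = cauchy x (½ ℚ.* ε) (0<½* 0<ε)
      N , q = cauchy y (½ ℚ.* ε) (0<½* 0<ε)
  in M ℕ.⊔ N , λ m n hm hn →
  subst (λ e → Near e (approx x m ℚ.+ approx y m) (approx x n ℚ.+ approx y n)) (halves ε)
    (near-+ {x = approx x m} {approx x n} {approx y m} {approx y n}
      (p m n (ℕ.m⊔n≤o⇒m≤o M N hm) (ℕ.m⊔n≤o⇒m≤o M N hn))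
      (q m n (ℕ.m⊔n≤o⇒n≤o M N hm) (ℕ.m⊔n≤o⇒n≤o M N hn)))

-ᴿ_ : ℝ → ℝ
approx (-ᴿ x) n = ℚ.- approx x n
cauchy (-ᴿ x) ε 0<ε = let N , p = cauchy x ε 0<ε in N , λ m n hm hn → near-neg {x = approx x m} {approx x n} (p m n hm hn)

_-ᴿ_ : ℝ → ℝ → ℝ
x -ᴿ y = x +ᴿ (-ᴿ y)

∣_∣ᴿ : ℝ → ℝ
approx ∣ x ∣ᴿ n = ℚ.∣ approx x n ∣
cauchy ∣ x ∣ᴿ ε 0<ε = let N , p = cauchy x ε 0<ε in N , λ m n hm hn → near-∣∣ {x = approx x m} {approx x n} (p m n hm hn)

split : ∀ K L {ε} → 0ℚ ℚ.< ε → Σ[ δ ∈ ℚ ] Σ[ γ ∈ ℚ ] 0ℚ ℚ.< δ × 0ℚ ℚ.< γ ×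
        (fromℕ (suc L) ℚ.* δ ℚ.+ fromℕ (suc K) ℚ.* γ ≡ ε)
split K L {ε} 0<ε =
  let δ , 0<δ , e = divide (0<fromℕ L) (0<½* 0<ε)
      γ , 0<γ , f = divide (0<fromℕ K) (0<½* 0<ε)
  in δ , γ , 0<δ , 0<γ , trans (cong₂ ℚ._+_ e f) (halves ε)

_*ᴿ_ : ℝ → ℝ → ℝ
approx (x *ᴿ y) n = approx x n ℚ.* approx y n
cauchy (x *ᴿ y) ε 0<ε =
  let K , A , bx = bound⁺ x
      L , B , by = bound⁺ y
      δ , γ , 0<δ , 0<γ , e = split K L 0<ε
      M , p = cauchy x δ 0<δ
      N , q = cauchy y γ 0<γ
  in (A ℕ.⊔ B) ℕ.⊔ (M ℕ.⊔ N) , λ m n hm hn →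
  subst (λ e → Near e (approx x m ℚ.* approx y m) (approx x n ℚ.* approx y n)) e
    (near-* {x = approx x m} {approx x n} {approx y m} {approx y n}
      (0≤fromℕ (suc K)) (0≤fromℕ (suc L))
      (bx m (ℕ.m⊔n≤o⇒m≤o A B (ℕ.m⊔n≤o⇒m≤o (A ℕ.⊔ B) (M ℕ.⊔ N) hm)))
      (by n (ℕ.m⊔n≤o⇒n≤o A B (ℕ.m⊔n≤o⇒m≤o (A ℕ.⊔ B) (M ℕ.⊔ N) hn)))
      (p m n (ℕ.m⊔n≤o⇒m≤o M N (ℕ.m⊔n≤o⇒n≤o (A ℕ.⊔ B) (M ℕ.⊔ N) hm))
             (ℕ.m⊔n≤o⇒m≤o M N (ℕ.m⊔n≤o⇒n≤o (A ℕ.⊔ B) (M ℕ.⊔ N) hn)))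
      (q m n (ℕ.m⊔n≤o⇒n≤o M N (ℕ.m⊔n≤o⇒n≤o (A ℕ.⊔ B) (M ℕ.⊔ N) hm))
             (ℕ.m⊔n≤o⇒n≤o M N (ℕ.m⊔n≤o⇒n≤o (A ℕ.⊔ B) (M ℕ.⊔ N) hn))))

≡⇒≃ : ∀ {x y} → (∀ n → approx x n ≡ approx y n) → x ≃ y
≡⇒≃ {x} {y} e = mk≃ λ ε 0<ε → 0 , λ n _ →
  subst (Near ε (approx x n)) (e n) (near-refl {x = approx x n} 0<ε)

≃-refl : ∀ {x} → x ≃ x
≃-refl {x} = ≡⇒≃ λ _ → refl

≃-sym : ∀ {x y} → x ≃ y → y ≃ x
≃-sym {x} {y} h = mk≃ λ ε 0<ε →
  eventually-map (λ n → near-sym {x = approx x n} {approx y n}) (close h ε 0<ε)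

≃-trans : ∀ {x y z} → x ≃ y → y ≃ z → x ≃ z
≃-trans {x} {y} {z} h k = mk≃ λ ε 0<ε →
  both (λ n p q → subst (λ e → Near e (approx x n) (approx z n)) (halves ε)
         (near-trans {x = approx x n} {approx y n} {approx z n} p q))
    (close h (½ ℚ.* ε) (0<½* 0<ε)) (close k (½ ℚ.* ε) (0<½* 0<ε))

+ᴿ-cong : ∀ {x y z w} → x ≃ y → z ≃ w → x +ᴿ z ≃ y +ᴿ w
+ᴿ-cong {x} {y} {z} {w} h k = mk≃ λ ε 0<ε →
  both (λ n p q → subst
         (λ e → Near e (approx x n ℚ.+ approx z n) (approx y n ℚ.+ approx w n)) (halves ε)
         (near-+ {x = approx x n} {approx y n} {approx z n} {approx w n} p q))
    (close h (½ ℚ.* ε) (0<½* 0<ε)) (close k (½ ℚ.* ε) (0<½* 0<ε))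

-ᴿ-cong : ∀ {x y} → x ≃ y → -ᴿ x ≃ -ᴿ y
-ᴿ-cong {x} {y} h = mk≃ λ ε 0<ε →
  eventually-map (λ n → near-neg {x = approx x n} {approx y n}) (close h ε 0<ε)

*ᴿ-cong : ∀ {x y z w} → x ≃ y → z ≃ w → x *ᴿ z ≃ y *ᴿ w
*ᴿ-cong {x} {y} {z} {w} h k = mk≃ λ ε 0<ε →
  let K , bx = bound⁺ x
      L , bw = bound⁺ w
      δ , γ , 0<δ , 0<γ , e = split K L 0<ε
  in
  both (λ n (bx , bw) (p , q) → subst
         (λ e → Near e (approx x n ℚ.* approx z n) (approx y n ℚ.* approx w n)) e
         (near-* {x = approx x n} {approx y n} {approx z n} {approx w n}
           (0≤fromℕ (suc K)) (0≤fromℕ (suc L)) bx bw p q))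
    (both (λ _ → _,_) bx bw) (both (λ _ → _,_) (close h δ 0<δ) (close k γ 0<γ))

ℝ-commutativeRing : CommutativeRing 0ℓ 0ℓ
ℝ-commutativeRing = record
  { Carrier = ℝ
  ; _≈_ = _≃_
  ; _+_ = _+ᴿ_
  ; _*_ = _*ᴿ_
  ; -_ = -ᴿ_
  ; 0# = 0ᴿ
  ; 1# = 1ᴿ
  ; isCommutativeRing = record
    { isRing = record
      { +-isAbelianGroup = record
        { isGroup = record
          { isMonoid = record
            { isSemigroup = record
              { isMagma = record
                { isEquivalence = record
                  { refl = λ {x} → ≃-refl {x}
                  ; sym = λ {x} {y} → ≃-sym {x} {y}
                  ; trans = λ {x} {y} {z} → ≃-trans {x} {y} {z}
                  }
                ; ∙-cong = λ {x} {y} {z} {w} → +ᴿ-cong {x} {y} {z} {w}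
                }
              ; assoc = λ x y z → ≡⇒≃
                  λ n → ℚ.+-assoc (approx x n) (approx y n) (approx z n)
              }
            ; identity = (λ x → ≡⇒≃ λ n → ℚ.+-identityˡ (approx x n))
                       , (λ x → ≡⇒≃ λ n → ℚ.+-identityʳ (approx x n))
            }
          ; inverse = (λ x → ≡⇒≃ λ n → ℚ.+-inverseˡ (approx x n))
                    , (λ x → ≡⇒≃ λ n → ℚ.+-inverseʳ (approx x n))
          ; ⁻¹-cong = λ {x} {y} → -ᴿ-cong {x} {y}
          }
        ; comm = λ x y → ≡⇒≃ λ n → ℚ.+-comm (approx x n) (approx y n)
        }
      ; *-cong = λ {x} {y} {z} {w} → *ᴿ-cong {x} {y} {z} {w}
      ; *-assoc = λ x y z → ≡⇒≃
          λ n → ℚ.*-assoc (approx x n) (approx y n) (approx z n)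
      ; *-identity = (λ x → ≡⇒≃ λ n → ℚ.*-identityˡ (approx x n))
                   , (λ x → ≡⇒≃ λ n → ℚ.*-identityʳ (approx x n))
      ; distrib = (λ x y z → ≡⇒≃
                    λ n → ℚ.*-distribˡ-+ (approx x n) (approx y n) (approx z n))
                , (λ x y z → ≡⇒≃
                    λ n → ℚ.*-distribʳ-+ (approx x n) (approx y n) (approx z n))
      }
    ; *-comm = λ x y → ≡⇒≃ λ n → ℚ.*-comm (approx x n) (approx y n)
    }
  }

bounded-+ : ∀ {x y p q} → Bounded x p → Bounded y q → Bounded (x +ᴿ y) (p ℚ.+ q)
bounded-+ {x} {y} = both λ n h k →
  ℚ.≤-trans (ℚ.∣p+q∣≤∣p∣+∣q∣ (approx x n) (approx y n)) (ℚ.+-mono-≤ h k)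

bounded-neg : ∀ {x p} → Bounded x p → Bounded (-ᴿ x) p
bounded-neg {x} {p} = eventually-map λ n →
  subst (ℚ._≤ p) (sym (ℚ.∣-p∣≡∣p∣ (approx x n)))

bounded-* : ∀ {x y p q} → Bounded x p → Bounded y q → Bounded (x *ᴿ y) (p ℚ.* q)
bounded-* {x} {y} {p} {q} hx hy = both (λ n h k →
  subst (ℚ._≤ p ℚ.* q) (sym (ℚ.∣p*q∣≡∣p∣*∣q∣ (approx x n) (approx y n)))
    (*-mono-≤ (ℚ.0≤∣p∣ (approx x n)) (bounded⇒0≤ {y} hy) h k)) hx hy

infix 4 _⟶_

_⟶_ : (ℕ → ℝ) → ℝ → Set
a ⟶ l = ∀ ε → 0ℚ ℚ.< ε → Eventually λ n → ∣ a n -ᴿ l ∣ᴿ ≤ᴿ fromℚ ε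

Cauchyᴿ : (ℕ → ℝ) → Set
Cauchyᴿ a = ∀ ε → 0ℚ ℚ.< ε →
  ∃[ N ] (∀ m n → N ℕ.≤ m → N ℕ.≤ n → ∣ a m -ᴿ a n ∣ᴿ ≤ᴿ fromℚ ε)

module Completeness (a : ℕ → ℝ) (a-cauchy : Cauchyᴿ a) where

  index : ℕ → ℕ
  index j = proj₁ (a-cauchy (unit j) (0<unit j))

  depth : ℕ → ℕ
  depth j = proj₁ (cauchy (a (index j)) (unit j) (0<unit j))

  diagonal : ℕ → ℚ
  diagonal j = approx (a (index j)) (depth j)

  diagonal-close : ∀ j → Eventually λ i → Near (unit j) (approx (a (index j)) i) (diagonal j)
  diagonal-close j = depth j , λ i h →
    proj₂ (cauchy (a (index j)) (unit j) (0<unit j)) i (depth j) h ℕ.≤-refl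

  tail-close : ∀ j n → index j ℕ.≤ n → ∀ η → 0ℚ ℚ.< η →
    Eventually λ i → Near (unit j ℚ.+ η) (approx (a (index j)) i) (approx (a n) i)
  tail-close j n h = below (proj₂ (a-cauchy (unit j) (0<unit j)) (index j) n ℕ.≤-refl h)

  at : ∀ {P : ℕ → Set} {A : Set} → (∀ i → P i → A) → Eventually P → A
  at f (N , p) = f N (p N ℕ.≤-refl)

  term-close : ∀ j n → index j ℕ.≤ n → ∀ η → 0ℚ ℚ.< η →
    Eventually λ i → Near (unit j ℚ.+ (unit j ℚ.+ η)) (diagonal j) (approx (a n) i)
  term-close j n h η 0<η = both
    (λ i p q → near-trans {x = diagonal j} {approx (a (index j)) i} {approx (a n) i}
      (near-sym {x = approx (a (index j)) i} {diagonal j} p) q)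
    (diagonal-close j) (tail-close j n h η 0<η)

  pair-close : ∀ J j k → J ℕ.≤ j → J ℕ.≤ k →
    Near ((ℤ.+ 6 ℚ./ 1) ℚ.* unit J) (diagonal j) (diagonal k)
  pair-close J j k J≤j J≤k = ℚ.≤-trans
    (at (λ i (p , q) → near-trans {x = diagonal j} {approx (a n) i} {diagonal k}
          p (near-sym {x = diagonal k} {approx (a n) i} q))
      (both (λ _ → _,_) (term-close j n (ℕ.m≤m⊔n _ _) u 0<u)
                        (term-close k n (ℕ.m≤n⊔m _ _) u 0<u)))
    (ℚ.≤-trans (ℚ.+-mono-≤ (ℚ.+-mono-≤ uj (ℚ.+-monoˡ-≤ u uj)) (ℚ.+-mono-≤ uk (ℚ.+-monoˡ-≤ u uk)))
      (ℚ.≤-reflexive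
        (solve 1 (λ u → (u :+ (u :+ u)) :+ (u :+ (u :+ u)) := con ((ℤ.+ 6 ℚ./ 1)) :* u) refl u)))
    where
    open +-*-Solver
    n : ℕ
    n = index j ℕ.⊔ index k
    u : ℚ
    u = unit J
    0<u : 0ℚ ℚ.< u
    0<u = 0<unit J
    uj : unit j ℚ.≤ u
    uj = unit-antitone J≤j
    uk : unit k ℚ.≤ u
    uk = unit-antitone J≤k

  scaled-unit : ∀ K {ε} → 0ℚ ℚ.< K → 0ℚ ℚ.< ε → ∃[ J ] K ℚ.* unit J ℚ.≤ ε
  scaled-unit K 0<K 0<ε =
    let δ , 0<δ , e = divide 0<K 0<ε
        J , h = unit-≤ δ 0<δ
    in J , subst (K ℚ.* unit J ℚ.≤_) e
    (ℚ.*-monoˡ-≤-nonNeg K {{ℚ.nonNegative (ℚ.<⇒≤ 0<K)}} h)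

  limit : ℝ
  approx limit = diagonal
  cauchy limit ε 0<ε =
    let J , h = scaled-unit (ℤ.+ 6 ℚ./ 1) (ℚ.positive⁻¹ _) 0<ε in J , λ j k J≤j J≤k → ℚ.≤-trans (pair-close J j k J≤j J≤k) h

  limit-close : ∀ J n → index J ℕ.≤ n → ∀ η → 0ℚ ℚ.< η →
    Eventually λ i → Near ((ℤ.+ 8 ℚ./ 1) ℚ.* unit J ℚ.+ η) (approx (a n) i) (diagonal i)
  limit-close J n J≤n η 0<η = both
    (λ i p J≤i → subst (λ e → Near e (approx (a n) i) (diagonal i)) (regroup (unit J) η)
      (near-trans {x = approx (a n) i} {diagonal J} {diagonal i}
        (near-sym {x = diagonal J} {approx (a n) i} p) (pair-close J J i ℕ.≤-refl J≤i)))
    (term-close J n J≤n η 0<η) (J , λ _ h → h)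
    where
    open +-*-Solver
    regroup : ∀ u η → (u ℚ.+ (u ℚ.+ η)) ℚ.+ (ℤ.+ 6 ℚ./ 1) ℚ.* u ≡ (ℤ.+ 8 ℚ./ 1) ℚ.* u ℚ.+ η
    regroup = solve 2 (λ u η →
      (u :+ (u :+ η)) :+ con (ℤ.+ 6 ℚ./ 1) :* u := con (ℤ.+ 8 ℚ./ 1) :* u :+ η) refl

  limit-near : ∀ J {ε} → (ℤ.+ 8 ℚ./ 1) ℚ.* unit J ℚ.≤ ε →
    Eventually λ n → ∣ a n -ᴿ limit ∣ᴿ ≤ᴿ fromℚ ε
  limit-near J h = index J , λ n J≤n → mk≤ λ η 0<η →
    eventually-map (λ i p → ℚ.≤-trans p (ℚ.+-monoˡ-≤ η h)) (limit-close J n J≤n η 0<η)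

  limit-correct : a ⟶ limit
  limit-correct ε 0<ε =
    let J , h = scaled-unit (ℤ.+ 8 ℚ./ 1) (ℚ.positive⁻¹ _) 0<ε in limit-near J h

open Completeness public using () renaming (limit to lim; limit-correct to lim-correct)

-- Here s plays the role of the partial sums of a series dominated by a geometric
-- series.
module GeometricSeries (s : ℕ → ℝ) (C : ℕ)
  (step : ∀ n → Bounded (s (suc n) -ᴿ s n) (fromℕ (suc C) ℚ.* recip (2 ℕ.^ n) {{ℕ.m^n≢0 2 n}}))
  where
  open +-*-Solver

  K : ℚ
  K = fromℕ (suc C)

  h : ℕ → ℚ
  h n = recip (2 ℕ.^ n) {{ℕ.m^n≢0 2 n}}

  2ℚ : ℚ
  2ℚ = ℤ.+ 2 ℚ./ 1

  h-double : ∀ n → h n ≡ 2ℚ ℚ.* h (suc n)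
  h-double n = trans (sym (ℚ.*-identityˡ (h n))) (trans (cong (ℚ._* h n) (sym fromℕ-1))
    (trans (frac-≡ 1 (2 ℕ.^ n) 2 (2 ℕ.^ suc n) {{ℕ.m^n≢0 2 n}} {{ℕ.m^n≢0 2 (suc n)}}
             (ℕ.*-identityˡ (2 ℕ.^ suc n)))
      (cong (ℚ._* h (suc n)) fromℕ-2)))
    where
    fromℕ-2 : fromℕ 2 ≡ 2ℚ
    fromℕ-2 = trans (fromℕ-suc 1) (cong (1ℚ ℚ.+_) fromℕ-1)

  n<2^n : ∀ n → suc n ℕ.≤ 2 ℕ.^ n
  n<2^n zero = s≤s z≤n
  n<2^n (suc n) = ℕ.≤-trans (s≤s (ℕ.m≤n+m (suc n) n))
    (ℕ.≤-trans (ℕ.+-mono-≤ (n<2^n n) (n<2^n n))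
      (ℕ.≤-reflexive (cong (2 ℕ.^ n ℕ.+_) (sym (ℕ.+-identityʳ (2 ℕ.^ n))))))

  h-≤ : ∀ n → h n ℚ.≤ unit n
  h-≤ n = subst₂ ℚ._≤_ (one (h n)) (one (unit n))
    (frac-≤ 1 (2 ℕ.^ n) 1 (suc n) {{ℕ.m^n≢0 2 n}} (ℕ.+-monoˡ-≤ 0 (n<2^n n)))
    where
    one : ∀ p → fromℕ 1 ℚ.* p ≡ p
    one p = trans (cong (ℚ._* p) fromℕ-1) (ℚ.*-identityˡ p)

  tail : ∀ n d → Bounded (s (d ℕ.+ n) -ᴿ s n) (2ℚ ℚ.* K ℚ.* (h n ℚ.- h (d ℕ.+ n)))
  tail n zero = 0 , λ i _ → ℚ.≤-reflexive
    (trans (cong ℚ.∣_∣ (ℚ.+-inverseʳ (approx (s n) i)))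
      (solve 2 (λ k x → con 0ℚ := con 2ℚ :* k :* (x :- x)) refl K (h n)))
  tail n (suc d) = both
    (λ i p q → subst₂ ℚ._≤_
      (cong ℚ.∣_∣ (solve 3 (λ x y z → (x :- y) :+ (y :- z) := x :- z) refl
        (approx (s (suc d ℕ.+ n)) i) (approx (s (d ℕ.+ n)) i) (approx (s n) i)))
      (trans (cong (λ b → K ℚ.* b ℚ.+ 2ℚ ℚ.* K ℚ.* (h n ℚ.- b)) (h-double (d ℕ.+ n)))
        (solve 3 (λ k x b → k :* (con 2ℚ :* b) :+ con 2ℚ :* k :* (x :- con 2ℚ :* b)
                            := con 2ℚ :* k :* (x :- b))
          refl K (h n) (h (suc d ℕ.+ n))))
      (ℚ.≤-trans
        (ℚ.∣p+q∣≤∣p∣+∣q∣ (approx (s (suc d ℕ.+ n)) i ℚ.- approx (s (d ℕ.+ n)) i)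
                        (approx (s (d ℕ.+ n)) i ℚ.- approx (s n) i))
        (ℚ.+-mono-≤ p q)))
    (step (d ℕ.+ n)) (tail n d)

  0<2K : 0ℚ ℚ.< 2ℚ ℚ.* K
  0<2K = ℚ.positive⁻¹ (2ℚ ℚ.* K)
    {{ℚ.pos*pos⇒pos 2ℚ K {{ℚ.positive (0<fromℕ C)}}}}

  tail-≤ : ∀ N m → N ℕ.≤ m → Bounded (s m -ᴿ s N) (2ℚ ℚ.* K ℚ.* unit N)
  tail-≤ N m N≤m = subst (λ m → Bounded (s m -ᴿ s N) (2ℚ ℚ.* K ℚ.* unit N)) (ℕ.m∸n+n≡m N≤m)
    (bounded-weaken {s (d ℕ.+ N) -ᴿ s N}
      (ℚ.*-monoˡ-≤-nonNeg (2ℚ ℚ.* K) {{ℚ.nonNegative (ℚ.<⇒≤ 0<2K)}}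
        (ℚ.≤-trans (drop (ℚ.<⇒≤ (0<recip (2 ℕ.^ (d ℕ.+ N)) {{ℕ.m^n≢0 2 (d ℕ.+ N)}}))) (h-≤ N)))
      (tail N d))
    where
    d : ℕ
    d = m ℕ.∸ N
    drop : ∀ {p q} → 0ℚ ℚ.≤ q → p ℚ.- q ℚ.≤ p
    drop {p} {q} 0≤q = subst (p ℚ.- q ℚ.≤_) (ℚ.+-identityʳ p)
      (ℚ.+-monoʳ-≤ p (ℚ.neg-antimono-≤ 0≤q))

  geometric⇒cauchy : Cauchyᴿ s
  geometric⇒cauchy ε 0<ε =
    let δ , 0<δ , e = divide 0<2K (0<½* 0<ε)
        N , u≤δ = unit-≤ δ 0<δ
        2Ku≤½ε = subst (2ℚ ℚ.* K ℚ.* unit N ℚ.≤_) e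
                   (ℚ.*-monoˡ-≤-nonNeg (2ℚ ℚ.* K) {{ℚ.nonNegative (ℚ.<⇒≤ 0<2K)}} u≤δ)
    in N , λ m n N≤m N≤n → mk≤ λ η 0<η → both
      (λ i p q → ℚ.≤-trans
        (near-trans {x = approx (s m) i} {approx (s N) i} {approx (s n) i} p
          (near-sym {x = approx (s n) i} {approx (s N) i} q))
        (ℚ.≤-trans (ℚ.≤-reflexive (sym (ℚ.+-identityʳ _)))
          (ℚ.+-mono-≤ (subst (2ℚ ℚ.* K ℚ.* unit N ℚ.+ 2ℚ ℚ.* K ℚ.* unit N ℚ.≤_) (halves ε)
                        (ℚ.+-mono-≤ 2Ku≤½ε 2Ku≤½ε))
                      (ℚ.<⇒≤ 0<η))))
      (tail-≤ N m N≤m) (tail-≤ N n N≤n)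

open GeometricSeries public using (geometric⇒cauchy)

power≤factorial : ∀ Q k → suc Q ℕ.^ k ℕ.≤ suc Q ℕ.^ suc Q ℕ.* k !
power≤factorial Q zero = ℕ.≤-trans (ℕ.m^n>0 (suc Q) (suc Q)) (ℕ.m≤m*n _ 1)
power≤factorial Q (suc k) with suc k ℕ.≤? suc Q
... | yes k≤Q = ℕ.≤-trans (ℕ.^-monoʳ-≤ (suc Q) k≤Q)
                  (ℕ.m≤m*n (suc Q ℕ.^ suc Q) (suc k !) {{suc k ℕ.!≢0}})
... | no k≰Q = ℕ.≤-trans (ℕ.*-mono-≤ (ℕ.<⇒≤ (ℕ.≰⇒> k≰Q)) (power≤factorial Q k))
  (ℕ.≤-reflexive (trans (sym (ℕ.*-assoc (suc k) (suc Q ℕ.^ suc Q) (k !)))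
    (trans (cong (ℕ._* k !) (ℕ.*-comm (suc k) (suc Q ℕ.^ suc Q)))
      (ℕ.*-assoc (suc Q ℕ.^ suc Q) (suc k) (k !)))))

*-^-distrib : ∀ m n k → (m ℕ.* n) ℕ.^ k ≡ m ℕ.^ k ℕ.* n ℕ.^ k
*-^-distrib m n zero = refl
*-^-distrib m n (suc k) = trans (cong (m ℕ.* n ℕ.*_) (*-^-distrib m n k))
  (solve 4 (λ m n p q → (m :* n) :* (p :* q) := (m :* p) :* (n :* q)) refl
    m n (m ℕ.^ k) (n ℕ.^ k))
  where open ℕ-Solver.+-*-Solver

expConstant : ℕ → ℕ
expConstant q = suc (2 ℕ.* q) ℕ.^ suc (2 ℕ.* q)

exp-domination : ∀ q k →
  fromℕ (q ℕ.^ k) ℚ.* recip (k !) {{k ℕ.!≢0}} ℚ.≤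
  fromℕ (suc (expConstant q)) ℚ.* recip (2 ℕ.^ k) {{ℕ.m^n≢0 2 k}}
exp-domination q k = frac-≤ (q ℕ.^ k) (k !) (suc (expConstant q)) (2 ℕ.^ k)
  {{k ℕ.!≢0}} {{ℕ.m^n≢0 2 k}}
  (ℕ.≤-trans (ℕ.≤-reflexive (trans (ℕ.*-comm (q ℕ.^ k) (2 ℕ.^ k)) (sym (*-^-distrib 2 q k))))
    (ℕ.≤-trans (ℕ.^-monoˡ-≤ k (ℕ.n≤1+n (2 ℕ.* q)))
      (ℕ.≤-trans (power≤factorial (2 ℕ.* q) k)
        (ℕ.*-monoˡ-≤ (k !) (ℕ.n≤1+n (expConstant q))))))

record ℂ : Set where
  constructor _+i_
  field
    re im : ℝ

open ℂ public

infix 4 _≈ᶜ_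
infixl 6 _+ᶜ_
infixl 7 _*ᶜ_
infix 8 -ᶜ_

record _≈ᶜ_ (z w : ℂ) : Set where
  constructor _,_
  field
    re-≃ : re z ≃ re w
    im-≃ : im z ≃ im w

open _≈ᶜ_ public

fromℝ : ℝ → ℂ
fromℝ x = x +i 0ᴿ

0ᶜ 1ᶜ 𝕚 : ℂ
0ᶜ = fromℝ 0ᴿ
1ᶜ = fromℝ 1ᴿ
𝕚 = 0ᴿ +i 1ᴿ

_+ᶜ_ : ℂ → ℂ → ℂ
z +ᶜ w = (re z +ᴿ re w) +i (im z +ᴿ im w)

-ᶜ_ : ℂ → ℂ
-ᶜ z = (-ᴿ re z) +i (-ᴿ im z)

_*ᶜ_ : ℂ → ℂ → ℂ
z *ᶜ w = (re z *ᴿ re w -ᴿ im z *ᴿ im w) +i (re z *ᴿ im w +ᴿ im z *ᴿ re w)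

≡⇒≈ᶜ : ∀ {z w} → (∀ n → approx (re z) n ≡ approx (re w) n) →
       (∀ n → approx (im z) n ≡ approx (im w) n) → z ≈ᶜ w
≡⇒≈ᶜ e f = ≡⇒≃ e , ≡⇒≃ f

*ᶜ-cong : ∀ {z z′ w w′} → z ≈ᶜ z′ → w ≈ᶜ w′ → z *ᶜ w ≈ᶜ z′ *ᶜ w′
*ᶜ-cong (e , f) (g , h) =
    R.+-cong (R.*-cong e g) (R.-‿cong (R.*-cong f h))
  , R.+-cong (R.*-cong e h) (R.*-cong f g)
  where module R = CommutativeRing ℝ-commutativeRing

module _ where
  open +-*-Solver

  *ᶜ-assoc : ∀ z w v → (z *ᶜ w) *ᶜ v ≈ᶜ z *ᶜ (w *ᶜ v)
  *ᶜ-assoc (a +i b) (c +i d) (e +i f) = ≡⇒≈ᶜ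
    {((a +i b) *ᶜ (c +i d)) *ᶜ (e +i f)} {(a +i b) *ᶜ ((c +i d) *ᶜ (e +i f))}
    (λ n → solve 6 (λ a b c d e f →
      (a :* c :- b :* d) :* e :- (a :* d :+ b :* c) :* f :=
      a :* (c :* e :- d :* f) :- b :* (c :* f :+ d :* e)) refl
      (approx a n) (approx b n) (approx c n) (approx d n) (approx e n) (approx f n))
    (λ n → solve 6 (λ a b c d e f →
      (a :* c :- b :* d) :* f :+ (a :* d :+ b :* c) :* e :=
      a :* (c :* f :+ d :* e) :+ b :* (c :* e :- d :* f)) refl
      (approx a n) (approx b n) (approx c n) (approx d n) (approx e n) (approx f n))

  *ᶜ-comm : ∀ z w → z *ᶜ w ≈ᶜ w *ᶜ z
  *ᶜ-comm (a +i b) (c +i d) = ≡⇒≈ᶜ {(a +i b) *ᶜ (c +i d)} {(c +i d) *ᶜ (a +i b)}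
    (λ n → solve 4 (λ a b c d → a :* c :- b :* d := c :* a :- d :* b) refl
      (approx a n) (approx b n) (approx c n) (approx d n))
    (λ n → solve 4 (λ a b c d → a :* d :+ b :* c := c :* b :+ d :* a) refl
      (approx a n) (approx b n) (approx c n) (approx d n))

  *ᶜ-identityˡ : ∀ z → 1ᶜ *ᶜ z ≈ᶜ z
  *ᶜ-identityˡ (a +i b) = ≡⇒≈ᶜ {1ᶜ *ᶜ (a +i b)} {a +i b}
    (λ n → solve 2 (λ a b → con 1ℚ :* a :- con 0ℚ :* b := a) refl (approx a n) (approx b n))
    (λ n → solve 2 (λ a b → con 1ℚ :* b :+ con 0ℚ :* a := b) refl (approx a n) (approx b n))

  *ᶜ-distribˡ : ∀ z w v → z *ᶜ (w +ᶜ v) ≈ᶜ z *ᶜ w +ᶜ z *ᶜ v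
  *ᶜ-distribˡ (a +i b) (c +i d) (e +i f) = ≡⇒≈ᶜ
    {(a +i b) *ᶜ ((c +i d) +ᶜ (e +i f))} {(a +i b) *ᶜ (c +i d) +ᶜ (a +i b) *ᶜ (e +i f)}
    (λ n → solve 6 (λ a b c d e f →
      a :* (c :+ e) :- b :* (d :+ f) := (a :* c :- b :* d) :+ (a :* e :- b :* f)) refl
      (approx a n) (approx b n) (approx c n) (approx d n) (approx e n) (approx f n))
    (λ n → solve 6 (λ a b c d e f →
      a :* (d :+ f) :+ b :* (c :+ e) := (a :* d :+ b :* c) :+ (a :* f :+ b :* e)) refl
      (approx a n) (approx b n) (approx c n) (approx d n) (approx e n) (approx f n))

ℂ-setoid : Setoid 0ℓ 0ℓ
ℂ-setoid = record
  { Carrier = ℂ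
  ; _≈_ = _≈ᶜ_
  ; isEquivalence = record
    { refl = R.refl , R.refl
    ; sym = λ (e , f) → R.sym e , R.sym f
    ; trans = λ (e , f) (g , h) → R.trans e g , R.trans f h
    }
  }
  where module R = CommutativeRing ℝ-commutativeRing

ℂ-commutativeRing : CommutativeRing 0ℓ 0ℓ
ℂ-commutativeRing = record
  { Carrier = ℂ
  ; _≈_ = _≈ᶜ_
  ; _+_ = _+ᶜ_
  ; _*_ = _*ᶜ_
  ; -_ = -ᶜ_
  ; 0# = 0ᶜ
  ; 1# = 1ᶜ
  ; isCommutativeRing = record
    { isRing = record
      { +-isAbelianGroup = record
        { isGroup = record
          { isMonoid = record
            { isSemigroup = record
              { isMagma = record
                { isEquivalence = Setoid.isEquivalence ℂ-setoid
                ; ∙-cong = λ (e , f) (g , h) → R.+-cong e g , R.+-cong f h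
                }
              ; assoc = λ z w v → R.+-assoc (re z) (re w) (re v)
                                , R.+-assoc (im z) (im w) (im v)
              }
            ; identity = (λ z → R.+-identityˡ (re z) , R.+-identityˡ (im z))
                       , (λ z → R.+-identityʳ (re z) , R.+-identityʳ (im z))
            }
          ; inverse = (λ z → R.-‿inverseˡ (re z) , R.-‿inverseˡ (im z))
                    , (λ z → R.-‿inverseʳ (re z) , R.-‿inverseʳ (im z))
          ; ⁻¹-cong = λ (e , f) → R.-‿cong e , R.-‿cong f
          }
        ; comm = λ z w → R.+-comm (re z) (re w) , R.+-comm (im z) (im w)
        }
      ; *-cong = λ {z} {z′} {w} {w′} → *ᶜ-cong {z} {z′} {w} {w′}
      ; *-assoc = *ᶜ-assoc
      ; *-identity = C.comm∧idˡ⇒id *ᶜ-comm *ᶜ-identityˡ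
      ; distrib = C.comm∧distrˡ⇒distr
          (λ {z} {z′} {w} {w′} (e , f) (g , h) → R.+-cong e g , R.+-cong f h)
          *ᶜ-comm *ᶜ-distribˡ
      }
    ; *-comm = *ᶜ-comm
    }
  }
  where
  module R = CommutativeRing ℝ-commutativeRing
  module C = Algebra.Consequences.Setoid ℂ-setoid

Boundedᶜ : ℂ → ℚ → Set
Boundedᶜ z q = Bounded (re z) q × Bounded (im z) q

boundedᶜ-weaken : ∀ {z p q} → p ℚ.≤ q → Boundedᶜ z p → Boundedᶜ z q
boundedᶜ-weaken {z} p≤q (h , k) = bounded-weaken {re z} p≤q h , bounded-weaken {im z} p≤q k

boundedᶜ-0 : ∀ n → Boundedᶜ 0ᶜ (fromℕ n)
boundedᶜ-0 n = (0 , λ _ _ → 0≤fromℕ n) , (0 , λ _ _ → 0≤fromℕ n)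

boundedᶜ-1 : Boundedᶜ 1ᶜ (fromℕ 1)
boundedᶜ-1 = (0 , λ _ _ → ℚ.≤-reflexive (sym fromℕ-1)) , (0 , λ _ _ → 0≤fromℕ 1)

boundedᶜ-+ : ∀ {z w m n} → Boundedᶜ z (fromℕ m) → Boundedᶜ w (fromℕ n) →
             Boundedᶜ (z +ᶜ w) (fromℕ (m ℕ.+ n))
boundedᶜ-+ {z} {w} {m} {n} (h , k) (h′ , k′) =
    subst (Bounded (re z +ᴿ re w)) (sym (fromℕ-+ m n)) (bounded-+ {re z} {re w} h h′)
  , subst (Bounded (im z +ᴿ im w)) (sym (fromℕ-+ m n)) (bounded-+ {im z} {im w} k k′)

boundedᶜ-* : ∀ {z w m n} → Boundedᶜ z (fromℕ m) → Boundedᶜ w (fromℕ n) →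
             Boundedᶜ (z *ᶜ w) (fromℕ (2 ℕ.* m ℕ.* n))
boundedᶜ-* {z} {w} {m} {n} (h , k) (h′ , k′) =
    subst (Bounded (re (z *ᶜ w))) eq
      (bounded-+ {re z *ᴿ re w} { -ᴿ (im z *ᴿ im w)} (bounded-* {re z} {re w} h h′)
        (bounded-neg {im z *ᴿ im w} (bounded-* {im z} {im w} k k′)))
  , subst (Bounded (im (z *ᶜ w))) eq
      (bounded-+ {re z *ᴿ im w} {im z *ᴿ re w} (bounded-* {re z} {im w} h k′)
        (bounded-* {im z} {re w} k h′))
  where
  eq : fromℕ m ℚ.* fromℕ n ℚ.+ fromℕ m ℚ.* fromℕ n ≡ fromℕ (2 ℕ.* m ℕ.* n)
  eq = trans (cong₂ ℚ._+_ (sym (fromℕ-* m n)) (sym (fromℕ-* m n)))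
    (trans (sym (fromℕ-+ (m ℕ.* n) (m ℕ.* n)))
      (cong fromℕ (solve 2 (λ m n → m :* n :+ m :* n := con 2 :* m :* n) refl m n)))
    where open ℕ-Solver.+-*-Solver

boundᶜ : ∀ z → Σ[ k ∈ ℕ ] Boundedᶜ z (fromℕ k)
boundᶜ z =
  let k , h = bound (re z)
      l , h′ = bound (im z)
  in k ℕ.⊔ l
   , bounded-weaken {re z} (fromℕ-mono-≤ (ℕ.m≤m⊔n k l)) h
   , bounded-weaken {im z} (fromℕ-mono-≤ (ℕ.m≤n⊔m k l)) h′

infix 4 _⟶ᶜ_

_⟶ᶜ_ : (ℕ → ℂ) → ℂ → Set
a ⟶ᶜ l = (re ∘ a) ⟶ re l × (im ∘ a) ⟶ im l

partialSum : (ℕ → ℂ) → ℕ → ℂ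
partialSum a zero    = 0ᶜ
partialSum a (suc n) = partialSum a n +ᶜ a n

_/!_ : ℂ → ℕ → ℂ
z /! k = fromℝ (fromℚ (recip (k !) {{k ℕ.!≢0}})) *ᶜ z

-- The sum over k of a k / k!, for sequences a whose growth is at most
-- exponential.
module ExponentialSeries (a : ℕ → ℂ) (q : ℕ) (a-bounded : ∀ k → Boundedᶜ (a k) (fromℕ (q ℕ.^ k)))
  where

  term : ℕ → ℂ
  term k = a k /! k

  r : ℕ → ℚ
  r k = recip (k !) {{k ℕ.!≢0}}

  dominated : ∀ k {x} → Bounded x (fromℕ (q ℕ.^ k)) → ∀ z →
    (∀ n → approx z n ≡ r k ℚ.* approx x n) →
    Bounded z (fromℕ (suc (expConstant q)) ℚ.* recip (2 ℕ.^ k) {{ℕ.m^n≢0 2 k}})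
  dominated k {x} (N , h) z e = N , λ n N≤n → ℚ.≤-trans
    (ℚ.≤-reflexive (trans (cong ℚ.∣_∣ (e n))
      (trans (ℚ.∣p*q∣≡∣p∣*∣q∣ (r k) (approx x n))
        (cong (ℚ._* ℚ.∣ approx x n ∣) (ℚ.0≤p⇒∣p∣≡p (ℚ.<⇒≤ (0<recip (k !) {{k ℕ.!≢0}})))))))
    (ℚ.≤-trans (ℚ.*-monoˡ-≤-nonNeg (r k)
                 {{ℚ.nonNegative (ℚ.<⇒≤ (0<recip (k !) {{k ℕ.!≢0}}))}} (h n N≤n))
      (ℚ.≤-trans (ℚ.≤-reflexive (ℚ.*-comm (r k) (fromℕ (q ℕ.^ k)))) (exp-domination q k)))

  increment : ∀ s x {p} → Bounded x p → Bounded ((s +ᴿ x) -ᴿ s) p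
  increment s x {p} = eventually-map λ n → subst (λ u → ℚ.∣ u ∣ ℚ.≤ p)
    (solve 2 (λ s x → x := (s :+ x) :- s) refl (approx s n) (approx x n))
    where open +-*-Solver

  re-step : ∀ n → Bounded (re (partialSum term (suc n)) -ᴿ re (partialSum term n))
              (fromℕ (suc (expConstant q)) ℚ.* recip (2 ℕ.^ n) {{ℕ.m^n≢0 2 n}})
  re-step n = increment (re (partialSum term n)) (re (term n))
    (dominated n {re (a n)} (proj₁ (a-bounded n)) (re (term n))
      λ i → solve 3 (λ r x y → r :* x :- con 0ℚ :* y := r :* x) refl
              (r n) (approx (re (a n)) i) (approx (im (a n)) i))
    where open +-*-Solver

  im-step : ∀ n → Bounded (im (partialSum term (suc n)) -ᴿ im (partialSum term n))
              (fromℕ (suc (expConstant q)) ℚ.* recip (2 ℕ.^ n) {{ℕ.m^n≢0 2 n}})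
  im-step n = increment (im (partialSum term n)) (im (term n))
    (dominated n {im (a n)} (proj₂ (a-bounded n)) (im (term n))
      λ i → solve 3 (λ r x y → r :* y :+ con 0ℚ :* x := r :* y) refl
              (r n) (approx (re (a n)) i) (approx (im (a n)) i))
    where open +-*-Solver

  re-cauchy : Cauchyᴿ (re ∘ partialSum term)
  re-cauchy = geometric⇒cauchy (re ∘ partialSum term) (expConstant q) re-step

  im-cauchy : Cauchyᴿ (im ∘ partialSum term)
  im-cauchy = geometric⇒cauchy (im ∘ partialSum term) (expConstant q) im-step

  value : ℂ
  value = lim (re ∘ partialSum term) re-cauchy +i lim (im ∘ partialSum term) im-cauchy

  value-correct : partialSum term ⟶ᶜ value
  value-correct = lim-correct (re ∘ partialSum term) re-cauchy
                , lim-correct (im ∘ partialSum term) im-cauchy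

module _ where
  open import Algebra.Properties.Semiring.Exp (CommutativeRing.semiring ℂ-commutativeRing)
    using (_^_)

  module ComplexExponential (z : ℂ) where

    K : ℕ
    K = proj₁ (boundᶜ z)

    power-bounded : ∀ k → Boundedᶜ (z ^ k) (fromℕ ((2 ℕ.* K) ℕ.^ k))
    power-bounded zero    = boundedᶜ-1
    power-bounded (suc k) = boundedᶜ-* {z} {z ^ k} {K} (proj₂ (boundᶜ z)) (power-bounded k)

    open ExponentialSeries (z ^_) (2 ℕ.* K) power-bounded public

  expᶜ : ℂ → ℂ
  expᶜ = ComplexExponential.value

  expᶜ-correct : ∀ z → partialSum (λ k → (z ^ k) /! k) ⟶ᶜ expᶜ z
  expᶜ-correct = ComplexExponential.value-correct

module LinearAlgebra {c ℓ} (R : CommutativeRing c ℓ) where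
  open CommutativeRing R
  open import Algebra.Properties.Semiring.Sum semiring public using (sum)

  infix  4 _≈ᵥ_
  infixl 6 _⊞_ _⊟_
  infixl 7 _⊗_ _*ᵥ_ _·ᵥ_ _·ₘ_
  infix  7 _∙_
  infixr 8 _^ₘ_

  Matrix : ℕ → ℕ → Set c
  Matrix m n = Fin m → Fin n → Carrier

  _≈ᵥ_ : ∀ {n} → Rel (Vector Carrier n) ℓ
  v ≈ᵥ w = ∀ i → v i ≈ w i

  0ᵥ 1ᵥ : ∀ {n} → Vector Carrier n
  0ᵥ _ = 0#
  1ᵥ _ = 1#

  _∙_ : ∀ {n} → Vector Carrier n → Vector Carrier n → Carrier
  v ∙ w = sum λ i → v i * w i

  _·ᵥ_ : ∀ {n} → Carrier → Vector Carrier n → Vector Carrier n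
  (k ·ᵥ v) i = k * v i

  diagonal : ∀ {n} → Vector Carrier n → Matrix n n
  diagonal v i j = if does (i Fin.≟ j) then v i else 0#

  1ₘ : ∀ {n} → Matrix n n
  1ₘ = diagonal 1ᵥ

  _⊞_ _⊟_ : ∀ {m n} → Matrix m n → Matrix m n → Matrix m n
  (A ⊞ B) i j = A i j + B i j
  (A ⊟ B) i j = A i j - B i j

  _·ₘ_ : ∀ {m n} → Carrier → Matrix m n → Matrix m n
  (k ·ₘ A) i j = k * A i j

  _⊗_ : ∀ {l m n} → Matrix l m → Matrix m n → Matrix l n
  (A ⊗ B) i j = sum λ k → A i k * B k j

  _*ᵥ_ : ∀ {m n} → Matrix m n → Vector Carrier n → Vector Carrier m
  (A *ᵥ v) i = A i ∙ v

  _^ₘ_ : ∀ {n} → Matrix n n → ℕ → Matrix n n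
  A ^ₘ zero  = 1ₘ
  A ^ₘ suc k = A ⊗ A ^ₘ k

  IsEigenvector : ∀ {n} → Matrix n n → Vector Carrier n → Set _
  IsEigenvector A v = ¬ (v ≈ᵥ 0ᵥ) × ∃[ μ ] A *ᵥ v ≈ᵥ μ ·ᵥ v

module Real = LinearAlgebra ℝ-commutativeRing
module Complex = LinearAlgebra ℂ-commutativeRing

open Complex using (_^ₘ_)

uniform : ∀ {n} (P : Fin n → ℕ → Set) → (∀ i {k l} → k ℕ.≤ l → P i k → P i l) →
          (∀ i → ∃[ k ] P i k) → ∃[ k ] (∀ i → P i k)
uniform {zero}  P mono h = 0 , λ ()
uniform {suc n} P mono h =
  let k , p = h zero
      l , q = uniform (P ∘ suc) (mono ∘ suc) (h ∘ suc)
  in k ℕ.⊔ l , λ { zero    → mono zero (ℕ.m≤m⊔n k l) p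
                 ; (suc i) → mono (suc i) (ℕ.m≤n⊔m k l) (q i) }

sum-bounded : ∀ {n} (v : Vector ℂ n) K → (∀ i → Boundedᶜ (v i) (fromℕ K)) →
              Boundedᶜ (Complex.sum v) (fromℕ (n ℕ.* K))
sum-bounded {zero}  v K h = boundedᶜ-0 0
sum-bounded {suc n} v K h =
  boundedᶜ-+ {v zero} {Complex.sum (v ∘ suc)} {K} (h zero) (sum-bounded (v ∘ suc) K (h ∘ suc))

module MatrixExponential {n} (A : Complex.Matrix n n) where

  entries : ∃[ K ] (∀ i j → Boundedᶜ (A i j) (fromℕ K))
  entries = uniform (λ i K → ∀ j → Boundedᶜ (A i j) (fromℕ K))
    (λ i k≤l h j → boundedᶜ-weaken {A i j} (fromℕ-mono-≤ k≤l) (h j))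
    (λ i → uniform (λ j K → Boundedᶜ (A i j) (fromℕ K))
      (λ j k≤l → boundedᶜ-weaken {A i j} (fromℕ-mono-≤ k≤l))
      (λ j → boundᶜ (A i j)))

  K : ℕ
  K = proj₁ entries

  q : ℕ
  q = n ℕ.* (2 ℕ.* K)

  power-bounded : ∀ i j k → Boundedᶜ ((A ^ₘ k) i j) (fromℕ (q ℕ.^ k))
  power-bounded i j zero with does (i Fin.≟ j)
  ... | true  = boundedᶜ-1
  ... | false = boundedᶜ-0 1
  power-bounded i j (suc k) =
    subst (λ m → Boundedᶜ ((A ^ₘ suc k) i j) (fromℕ m)) (sym (ℕ.*-assoc n (2 ℕ.* K) (q ℕ.^ k)))
      (sum-bounded (λ l → A i l *ᶜ (A ^ₘ k) l j) (2 ℕ.* K ℕ.* q ℕ.^ k)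
        (λ l → boundedᶜ-* {A i l} {(A ^ₘ k) l j} {K} (proj₂ entries i l) (power-bounded l j k)))

  module Entry (i j : Fin n) =
    ExponentialSeries (λ k → (A ^ₘ k) i j) q (power-bounded i j)

expₘ : ∀ {n} → Complex.Matrix n n → Complex.Matrix n n
expₘ = MatrixExponential.Entry.value

expₘ-correct : ∀ {n} (A : Complex.Matrix n n) i j →
  partialSum (λ k → (A ^ₘ k) i j /! k) ⟶ᶜ expₘ A i j
expₘ-correct = MatrixExponential.Entry.value-correct

open import Data.Fin.Subset using (Subset; inside; outside; _∈_; ∣_∣; ⊤; ⊥)

-- ω u v is meaningful only when u ~ v.
record WeightedGraph (n : ℕ) : Set₁ where
  infix 4 _~_ _~?_
  field
    _~_      : Rel (Fin n) 0ℓ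
    _~?_     : Decidable _~_
    ~-sym    : Symmetric _~_
    ~-irrefl : Irreflexive _≡_ _~_
    ω        : Fin n → Fin n → ℝ
    ω-sym    : ∀ {u v} → u ~ v → ω u v ≃ ω v u
    ω-pos    : ∀ {u v} → u ~ v → 0ᴿ <ᴿ ω u v

Connected : ∀ {n} → WeightedGraph n → Set
Connected G = ∀ u v → Star _~_ u v
  where open WeightedGraph G

record IsCluster {n} (G : WeightedGraph n) (C S : Subset n) : Set where
  open WeightedGraph G
  field
    ∣C∣≥2         : 2 ℕ.≤ ∣ C ∣
    independent   : ∀ {u v} → u ∈ C → v ∈ C → ¬ u ~ v
    neighbourhood : ∀ {a} → a ∈ C → ∀ v → a ~ v ⇔ v ∈ S
    uniform-ω     : ∀ {v} → v ∈ S → ∀ {u u′} → u ∈ C → u′ ∈ C → ω u v ≃ ω u′ v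

-- The elements of S in increasing order.
element : ∀ {n} (S : Subset n) → Fin ∣ S ∣ → Fin n
element (inside  ∷ S) zero    = zero
element (inside  ∷ S) (suc k) = suc (element S k)
element (outside ∷ S) k       = suc (element S k)

weightsInto : ∀ {n} → WeightedGraph n → (S : Subset n) → Fin n → Vector ℝ ∣ S ∣
weightsInto G S u k = WeightedGraph.ω G u (element S k)

first : ∀ c m → Subset (c ℕ.+ m)
first c m = ⊤ {c} Vec.++ ⊥ {m}

-- H lives on the first c vertices of G. An edge present in both graphs would get
-- its weight from H; this does not happen when those vertices are independent in G.
module Union {c m} (G : WeightedGraph (c ℕ.+ m)) (H : WeightedGraph c) where
  module G = WeightedGraph G
  module H = WeightedGraph H

  V : Set
  V = Fin c ⊎ Fin m

  data _~ᴴ_ : Rel V 0ℓ where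
    inj₁ : ∀ {a b} → a H.~ b → inj₁ a ~ᴴ inj₁ b

  _~ᴴ?_ : Decidable _~ᴴ_
  inj₁ a ~ᴴ? inj₁ b = map′ inj₁ (λ { (inj₁ e) → e }) (a H.~? b)
  inj₁ _ ~ᴴ? inj₂ _ = no λ ()
  inj₂ _ ~ᴴ? _      = no λ ()

  ~ᴴ-sym : Symmetric _~ᴴ_
  ~ᴴ-sym (inj₁ e) = inj₁ (H.~-sym e)

  ~ᴴ-irrefl : ∀ {p} → ¬ p ~ᴴ p
  ~ᴴ-irrefl (inj₁ e) = H.~-irrefl refl e

  ωᴴ : V → V → ℝ → ℝ
  ωᴴ (inj₁ a) (inj₁ b) w = if does (a H.~? b) then H.ω a b else w
  ωᴴ _        _        w = w

  ωᴴ-sym : ∀ p q {w w′} → (¬ p ~ᴴ q → w ≃ w′) → ωᴴ p q w ≃ ωᴴ q p w′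
  ωᴴ-sym (inj₁ a) (inj₁ b) h with a H.~? b | b H.~? a
  ... | yes e | yes _ = H.ω-sym e
  ... | yes e | no ¬e = contradiction (H.~-sym e) ¬e
  ... | no ¬e | yes e = contradiction (H.~-sym e) ¬e
  ... | no ¬e | no _  = h λ { (inj₁ e) → ¬e e }
  ωᴴ-sym (inj₁ _) (inj₂ _) h = h λ ()
  ωᴴ-sym (inj₂ _) (inj₁ _) h = h λ ()
  ωᴴ-sym (inj₂ _) (inj₂ _) h = h λ ()

  ωᴴ-pos : ∀ p q {w} → (¬ p ~ᴴ q → 0ᴿ <ᴿ w) → 0ᴿ <ᴿ ωᴴ p q w
  ωᴴ-pos (inj₁ a) (inj₁ b) h with a H.~? b
  ... | yes e = H.ω-pos e
  ... | no ¬e = h λ { (inj₁ e) → ¬e e }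
  ωᴴ-pos (inj₁ _) (inj₂ _) h = h λ ()
  ωᴴ-pos (inj₂ _) (inj₁ _) h = h λ ()
  ωᴴ-pos (inj₂ _) (inj₂ _) h = h λ ()

  _⟨_⟩ : WeightedGraph (c ℕ.+ m)
  _⟨_⟩ = record
    { _~_      = λ u v → u G.~ v ⊎ splitAt c u ~ᴴ splitAt c v
    ; _~?_     = λ u v → (u G.~? v) ⊎-dec (splitAt c u ~ᴴ? splitAt c v)
    ; ~-sym    = Sum.map G.~-sym ~ᴴ-sym
    ; ~-irrefl = λ { refl (inj₁ e) → G.~-irrefl refl e ; refl (inj₂ e) → ~ᴴ-irrefl e }
    ; ω        = λ u v → ωᴴ (splitAt c u) (splitAt c v) (G.ω u v)
    ; ω-sym    = λ {u} {v} e → ωᴴ-sym (splitAt c u) (splitAt c v)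
                   λ ¬e → G.ω-sym (Sum.[ (λ e → e) , (λ e → contradiction e ¬e) ] e)
    ; ω-pos    = λ {u} {v} e → ωᴴ-pos (splitAt c u) (splitAt c v)
                   λ ¬e → G.ω-pos (Sum.[ (λ e → e) , (λ e → contradiction e ¬e) ] e)
    }

open Union public using (_⟨_⟩)

adjacency degree : ∀ {n} → WeightedGraph n → Real.Matrix n n
adjacency G u v = if does (u ~? v) then ω u v else 0ᴿ
  where open WeightedGraph G
degree G = Real.diagonal λ u → Real.sum (adjacency G u)

data MatrixKind : Set where
  𝐀 𝐋 𝐐 : MatrixKind

matrix : MatrixKind → ∀ {n} → WeightedGraph n → Real.Matrix n n
matrix 𝐀 G = adjacency G
matrix 𝐋 G = degree G Real.⊟ adjacency G
matrix 𝐐 G = degree G Real.⊞ adjacency G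

δ : MatrixKind → ℝ
δ 𝐀 = 0ᴿ
δ 𝐋 = 1ᴿ
δ 𝐐 = 1ᴿ

U : MatrixKind → ∀ {n} → WeightedGraph n → ℝ → Complex.Matrix n n
U M G t = expₘ ((𝕚 *ᶜ fromℝ t) Complex.·ₘ λ u v → fromℝ (matrix M G u v))

{-# OPTIONS --safe #-}
module Submission where

-- The cluster makes the matrix A of G(H) send a vector (y , 0) with vanishing coordinate
-- sum to ((B + ζ) y , 0), where B is the matrix of H and ζ the contribution of the degree
-- into S; since 1 is an eigenvector of the symmetric matrix B, such y form a B-invariant
-- subspace W. Hence, for y in W, the sequences A^k (y , 0) / k! and
-- Σ_l (ζ^l / l!) (B^(k-l) y / (k-l)!) have the same initial term and satisfy the same
-- recursion coming from the Leibniz rule, so they agree. The partial sums of the second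
-- converge to e^ζ e^B y by the Cauchy product of two exponentially dominated series.

open import Defs
open import Algebra.Bundles using (CommutativeRing)
import Algebra.Definitions.RawMonoid
import Algebra.Properties.Semiring.Exp
import Algebra.Properties.Semiring.Sum
import Algebra.Solver.Ring.NaturalCoefficients.Default
open import Data.Bool.Base using (true; false; if_then_else_)
open import Data.Fin.Base using (Fin; zero; suc; splitAt; _↑ˡ_; _↑ʳ_)
import Data.Fin.Properties as Fin
open import Data.Fin.Subset using (Subset; inside; outside; _∈_; ⊤; ⊥)
import Data.Integer.Base as ℤ
open import Data.Nat.Base as ℕ using (ℕ; zero; suc; _!)
import Data.Nat.Properties as ℕ
open import Data.Product.Base using (_×_; _,_; proj₁; proj₂)
open import Data.Rational.Base as ℚ using (ℚ; 0ℚ; 1ℚ; ½)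
import Data.Rational.Properties as ℚ
open import Data.Rational.Solver using (module +-*-Solver)
open import Data.Sum.Base using (_⊎_; inj₁; inj₂; [_,_])
open import Data.Vec.Base as Vec using (_∷_)
import Data.Vec.Properties as Vec
open import Data.Vec.Functional using (Vector; _++_; map)
open import Function.Base using (_∘_)
open import Function.Bundles using (Equivalence)
open import Relation.Binary.PropositionalEquality as ≡ using (_≡_)
import Relation.Binary.Reasoning.Setoid
open import Relation.Nullary using (¬_; Dec; yes; no; does; contradiction)
open import Relation.Nullary.Decidable.Core using (_⊎-dec_)

-- The law exp(X + Y) = exp X exp Y cannot be applied to the whole matrix: `A` acts as `B` plus a
-- scalar only on vectors (y , 0) with y of coordinate sum zero, and for other y the image need not
-- vanish outside C. The sum condition kills the lower block because a vertex outside C sees all of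
-- C with one weight, or not at all, so its row multiplies y to a multiple of that sum. Applying `B`
-- must not destroy the condition: constant row sums of the symmetric matrix are also constant
-- column sums, so 1ᵀB is a multiple of 1ᵀ. Since the recursion at y refers to By, the comparison of
-- coefficients has to run over all of W at once. This comparison is pure algebra, valid in any
-- commutative ring in which k + 1 cancels and inverse factorials are given. Analysis enters only
-- afterwards: an exponential is known solely as a limit of partial sums, so the result follows from
-- uniqueness of limits.

-- Absolute bounds, null sequences and limits of real sequences.

infix 4 _≼_

-- Unlike `Bounded`, this bound on the absolute value respects `_≃_`; the price is an arbitrarily
-- small rational slack in every estimate.
_≼_ : ℝ → ℚ → Set
x ≼ q = ∣ x ∣ᴿ ≤ᴿ fromℚ q

≼-resp : ∀ {x y q} → x ≃ y → x ≼ q → y ≼ q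
≼-resp {x} {y} {q} e h = mk≤ λ η 0<η → both
  (λ n p r → ≡.subst₂ ℚ._≤_
    (≡.cong ℚ.∣_∣ (solve 2 (λ x y → (y :- x) :+ x := y) ≡.refl (approx x n) (approx y n)))
    (≡.trans (solve 2 (λ q η → η :+ (q :+ η) := q :+ (η :+ η)) ≡.refl q (½ ℚ.* η))
      (≡.cong (q ℚ.+_) (halves η)))
    (ℚ.≤-trans (ℚ.∣p+q∣≤∣p∣+∣q∣ (approx y n ℚ.- approx x n) (approx x n))
      (ℚ.+-mono-≤ (near-sym {x = approx x n} {approx y n} p) r)))
  (close e (½ ℚ.* η) (0<½* 0<η)) (below h (½ ℚ.* η) (0<½* 0<η))
  where open +-*-Solver

≼-weaken : ∀ {x p q} → p ℚ.≤ q → x ≼ p → x ≼ q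
≼-weaken p≤q h = mk≤ λ η 0<η →
  eventually-map (λ n r → ℚ.≤-trans r (ℚ.+-monoˡ-≤ η p≤q)) (below h η 0<η)

bounded⇒≼ : ∀ {x q} → Bounded x q → x ≼ q
bounded⇒≼ {x} {q} h = mk≤ λ η 0<η → eventually-map
  (λ n r → ℚ.≤-trans r (≡.subst (ℚ._≤ q ℚ.+ η) (ℚ.+-identityʳ q) (ℚ.+-monoʳ-≤ q (ℚ.<⇒≤ 0<η)))) h

≼⇒bounded : ∀ {x q} → x ≼ q → Bounded x (q ℚ.+ 1ℚ)
≼⇒bounded h = below h 1ℚ (ℚ.positive⁻¹ 1ℚ)

≼-0 : ∀ {q} → 0ℚ ℚ.≤ q → 0ᴿ ≼ q
≼-0 0≤q = bounded⇒≼ (0 , λ _ _ → 0≤q)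

≼-+ : ∀ {x y p q} → x ≼ p → y ≼ q → x +ᴿ y ≼ p ℚ.+ q
≼-+ {x} {y} {p} {q} h k = mk≤ λ η 0<η → both
  (λ n r s → ≡.subst (ℚ.∣ approx x n ℚ.+ approx y n ∣ ℚ.≤_)
    (≡.trans (solve 3 (λ p q η → (p :+ η) :+ (q :+ η) := (p :+ q) :+ (η :+ η)) ≡.refl p q (½ ℚ.* η))
      (≡.cong (p ℚ.+ q ℚ.+_) (halves η)))
    (ℚ.≤-trans (ℚ.∣p+q∣≤∣p∣+∣q∣ (approx x n) (approx y n)) (ℚ.+-mono-≤ r s)))
  (below h (½ ℚ.* η) (0<½* 0<η)) (below k (½ ℚ.* η) (0<½* 0<η))
  where open +-*-Solver

≼-neg : ∀ {x p} → x ≼ p → -ᴿ x ≼ p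
≼-neg {x} {p} h = mk≤ λ η 0<η → eventually-map
  (λ n → ≡.subst (ℚ._≤ p ℚ.+ η) (≡.sym (ℚ.∣-p∣≡∣p∣ (approx x n)))) (below h η 0<η)

≼-*-bounded : ∀ {x y p q} → 0ℚ ℚ.< q → x ≼ p → Bounded y q → x *ᴿ y ≼ p ℚ.* q
≼-*-bounded {x} {y} {p} {q} 0<q h k = mk≤ λ η 0<η →
  let θ , 0<θ , e = divide 0<q 0<η in
  both (λ n r s → ≡.subst₂ ℚ._≤_
      (≡.sym (ℚ.∣p*q∣≡∣p∣*∣q∣ (approx x n) (approx y n)))
      (≡.trans (solve 3 (λ p q θ → (p :+ θ) :* q := p :* q :+ q :* θ) ≡.refl p q θ)
        (≡.cong (p ℚ.* q ℚ.+_) e))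
      (*-mono-≤ (ℚ.0≤∣p∣ (approx x n)) (ℚ.<⇒≤ 0<q) r s))
    (below h θ 0<θ) k
  where open +-*-Solver

-- By definition `a ⟶ l` is `Null` of the differences `a n -ᴿ l`, so the limit laws reduce to
-- closure properties of null sequences.
Null : (ℕ → ℝ) → Set
Null a = ∀ ε → 0ℚ ℚ.< ε → Eventually λ n → a n ≼ ε

null-cong : ∀ {a b} → (∀ n → a n ≃ b n) → Null a → Null b
null-cong e h ε 0<ε = eventually-map (λ n → ≼-resp (e n)) (h ε 0<ε)

null-+ : ∀ {a b} → Null a → Null b → Null (λ n → a n +ᴿ b n)
null-+ h k ε 0<ε = both
  (λ n p q → ≡.subst (_ ≼_) (halves ε) (≼-+ p q))
  (h (½ ℚ.* ε) (0<½* 0<ε)) (k (½ ℚ.* ε) (0<½* 0<ε))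

null-neg : ∀ {a} → Null a → Null (λ n → -ᴿ a n)
null-neg h ε 0<ε = eventually-map (λ _ → ≼-neg) (h ε 0<ε)

null-*-bounded : ∀ {a} (b : ℕ → ℝ) K → Null a →
                 Eventually (λ n → Bounded (b n) (fromℕ (suc K))) →
                 Null (λ n → a n *ᴿ b n)
null-*-bounded {a} b K h k ε 0<ε =
  let θ , 0<θ , e = divide (0<fromℕ K) 0<ε in
  both {Q = λ n → Bounded (b n) (fromℕ (suc K))}
    (λ n p q → ≡.subst (a n *ᴿ b n ≼_) (≡.trans (ℚ.*-comm θ (fromℕ (suc K))) e)
      (≼-*-bounded {y = b n} (0<fromℕ K) p q))
    (h θ 0<θ) k

null-* : ∀ {a b} → Null a → Null b → Null (λ n → a n *ᴿ b n)
-- With tolerance 1 the second factor is eventually `≼ 1ℚ`; the slack 1 turns this into `Bounded` by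
-- 2, which is the `suc 1` of `null-*-bounded`.
null-* {a} {b} h k = null-*-bounded b 1 h (eventually-map
  (λ n p → ≡.subst (Bounded (b n)) two (≼⇒bounded p)) (k 1ℚ (ℚ.positive⁻¹ 1ℚ)))
  where
  two : 1ℚ ℚ.+ 1ℚ ≡ fromℕ 2
  two = ≡.sym (≡.trans (fromℕ-suc 1) (≡.cong (1ℚ ℚ.+_) fromℕ-1))

null-*ʳ : ∀ {a} x → Null a → Null (λ n → a n *ᴿ x)
null-*ʳ x h = let K , N , k = bound⁺ x in null-*-bounded (λ _ → x) K h (0 , λ _ _ → N , k)

null-const : ∀ {x} → Null (λ _ → x) → x ≃ 0ᴿ
null-const {x} h = mk≃ λ ε 0<ε →
  let N , p = h (½ ℚ.* ε) (0<½* 0<ε) in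
  eventually-map (λ n → ≡.subst₂ ℚ._≤_
      (≡.cong ℚ.∣_∣ (≡.sym (ℚ.+-identityʳ (approx x n)))) (halves ε))
    (below (p N ℕ.≤-refl) (½ ℚ.* ε) (0<½* 0<ε))


⟶-cong : ∀ {a b l m} → (∀ n → a n ≃ b n) → l ≃ m → a ⟶ l → b ⟶ m
⟶-cong e f = null-cong λ n → +ᴿ-cong (e n) (-ᴿ-cong f)

⟶-const : ∀ x → (λ _ → x) ⟶ x
⟶-const x ε 0<ε = 0 , λ _ _ → ≼-resp
  (≡⇒≃ λ n → ≡.sym (ℚ.+-inverseʳ (approx x n))) (≼-0 (ℚ.<⇒≤ 0<ε))

⟶-+ : ∀ {a b l m} → a ⟶ l → b ⟶ m → (λ n → a n +ᴿ b n) ⟶ l +ᴿ m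
⟶-+ {a} {b} {l} {m} h k = null-cong
  (λ n → ≡⇒≃ λ i → solve 4 (λ a b l m → (a :- l) :+ (b :- m) := (a :+ b) :- (l :+ m)) ≡.refl
    (approx (a n) i) (approx (b n) i) (approx l i) (approx m i))
  (null-+ h k)
  where open +-*-Solver

⟶-neg : ∀ {a l} → a ⟶ l → (λ n → -ᴿ a n) ⟶ -ᴿ l
⟶-neg {a} {l} h = null-cong
  (λ n → ≡⇒≃ λ i → solve 2 (λ a l → :- (a :- l) := :- a :- :- l) ≡.refl
    (approx (a n) i) (approx l i))
  (null-neg h)
  where open +-*-Solver

-- Expanding around both limits, ab - lm = (a - l)(b - m) + (a - l)m + (b - m)l, leaves only
-- products of null sequences with null sequences or constants.
⟶-* : ∀ {a b l m} → a ⟶ l → b ⟶ m → (λ n → a n *ᴿ b n) ⟶ l *ᴿ m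
⟶-* {a} {b} {l} {m} h k = null-cong
  (λ n → ≡⇒≃ λ i → solve 4
    (λ a b l m → (a :- l) :* (b :- m) :+ ((a :- l) :* m :+ (b :- m) :* l) := a :* b :- l :* m) ≡.refl
    (approx (a n) i) (approx (b n) i) (approx l i) (approx m i))
  (null-+ (null-* h k) (null-+ (null-*ʳ m h) (null-*ʳ l k)))
  where open +-*-Solver

⟶-unique : ∀ {a l m} → a ⟶ l → a ⟶ m → l ≃ m
⟶-unique {a} {l} {m} h k = ≃-trans
  (≡⇒≃ {y = (l -ᴿ m) +ᴿ m}
    λ i → solve 2 (λ l m → l := (l :- m) :+ m) ≡.refl (approx l i) (approx m i))
  (≃-trans (+ᴿ-cong (null-const (null-cong
      (λ n → ≡⇒≃ λ i → solve 3 (λ a l m → (a :- m) :- (a :- l) := l :- m) ≡.refl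
        (approx (a n) i) (approx l i) (approx m i))
      (null-+ k (null-neg h)))) (≃-refl {m}))
    (≡⇒≃ λ i → ℚ.+-identityˡ (approx m i)))
  where open +-*-Solver

-- Limits of complex sequences.

module C = CommutativeRing ℂ-commutativeRing

⟶ᶜ-cong : ∀ {a b l m} → (∀ n → a n ≈ᶜ b n) → l ≈ᶜ m → a ⟶ᶜ l → b ⟶ᶜ m
⟶ᶜ-cong e f (h , k) = ⟶-cong (λ n → re-≃ (e n)) (re-≃ f) h , ⟶-cong (λ n → im-≃ (e n)) (im-≃ f) k

⟶ᶜ-const : ∀ z → (λ _ → z) ⟶ᶜ z
⟶ᶜ-const z = ⟶-const (re z) , ⟶-const (im z)

⟶ᶜ-+ : ∀ {a b l m} → a ⟶ᶜ l → b ⟶ᶜ m → (λ n → a n +ᶜ b n) ⟶ᶜ l +ᶜ m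
⟶ᶜ-+ (h , k) (h′ , k′) = ⟶-+ h h′ , ⟶-+ k k′

⟶ᶜ-* : ∀ {a b l m} → a ⟶ᶜ l → b ⟶ᶜ m → (λ n → a n *ᶜ b n) ⟶ᶜ l *ᶜ m
⟶ᶜ-* (h , k) (h′ , k′) =
  ⟶-+ (⟶-* h h′) (⟶-neg (⟶-* k k′)) , ⟶-+ (⟶-* h k′) (⟶-* k h′)

⟶ᶜ-unique : ∀ {a l m} → a ⟶ᶜ l → a ⟶ᶜ m → l ≈ᶜ m
⟶ᶜ-unique (h , k) (h′ , k′) = ⟶-unique h h′ , ⟶-unique k k′

⟶ᶜ-sum : ∀ {n} {a : ℕ → Fin n → ℂ} {l} → (∀ j → (λ k → a k j) ⟶ᶜ l j) →
         (λ k → Complex.sum (a k)) ⟶ᶜ Complex.sum l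
⟶ᶜ-sum {zero}  h = ⟶ᶜ-const 0ᶜ
⟶ᶜ-sum {suc n} h = ⟶ᶜ-+ (h zero) (⟶ᶜ-sum (λ j → h (suc j)))

-- Formal power series.

-- Sequences are read as coefficients of formal power series: ⋆ is the Cauchy product,
-- defined by recursion on its first factor, and D the derivative.
module Convolution {c ℓ} (R : CommutativeRing c ℓ) where
  open CommutativeRing R hiding (zero)
  open Algebra.Solver.Ring.NaturalCoefficients.Default commutativeSemiring
    using (solve; con; _:+_; _:*_; _:=_)
  open Algebra.Properties.Semiring.Sum semiring using (sum; ∑-distrib-+; *-distribˡ-sum)
  open Algebra.Definitions.RawMonoid +-rawMonoid using () renaming (_×_ to _·_)
  open Relation.Binary.Reasoning.Setoid setoid

  infixl 7 _⋆_

  _⋆_ : (ℕ → Carrier) → (ℕ → Carrier) → ℕ → Carrier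
  (a ⋆ b) zero    = a 0 * b 0
  (a ⋆ b) (suc n) = a 0 * b (suc n) + ((a ∘ suc) ⋆ b) n

  -- The number k in the ring, as an iterated sum: `ν (suc k)` unfolds to `1# + ν k`, so the solver
  -- can treat `ν k` as a variable.
  ν : ℕ → Carrier
  ν k = k · 1#

  D : (ℕ → Carrier) → ℕ → Carrier
  D a k = ν (suc k) * a (suc k)

  ⋆-cong : ∀ {a a′ b b′} → (∀ k → a k ≈ a′ k) → (∀ k → b k ≈ b′ k) →
           ∀ n → (a ⋆ b) n ≈ (a′ ⋆ b′) n
  ⋆-cong e f zero    = *-cong (e 0) (f 0)
  ⋆-cong e f (suc n) = +-cong (*-cong (e 0) (f (suc n))) (⋆-cong (e ∘ suc) f n)

  ⋆-distribʳ-+ : ∀ a a′ b n → ((λ k → a k + a′ k) ⋆ b) n ≈ (a ⋆ b) n + (a′ ⋆ b) n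
  ⋆-distribʳ-+ a a′ b zero    = distribʳ (b 0) (a 0) (a′ 0)
  ⋆-distribʳ-+ a a′ b (suc n) = trans (+-congˡ (⋆-distribʳ-+ (a ∘ suc) (a′ ∘ suc) b n))
    (solve 5 (λ x y z u v → (x :+ y) :* z :+ (u :+ v) := (x :* z :+ u) :+ (y :* z :+ v)) refl
      (a 0) (a′ 0) (b (suc n)) (((a ∘ suc) ⋆ b) n) (((a′ ∘ suc) ⋆ b) n))

  ⋆-*ˡ : ∀ z a b n → ((λ k → z * a k) ⋆ b) n ≈ z * (a ⋆ b) n
  ⋆-*ˡ z a b zero    = *-assoc z (a 0) (b 0)
  ⋆-*ˡ z a b (suc n) = trans (+-cong (*-assoc z (a 0) (b (suc n))) (⋆-*ˡ z (a ∘ suc) b n))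
    (sym (distribˡ z _ _))

  ⋆-sum : ∀ {m} a (b : Fin m → ℕ → Carrier) n →
          (a ⋆ λ k → sum λ j → b j k) n ≈ sum λ j → (a ⋆ b j) n
  ⋆-sum a b zero    = *-distribˡ-sum (a 0) (λ j → b j 0)
  ⋆-sum a b (suc n) = trans
    (+-cong (*-distribˡ-sum (a 0) (λ j → b j (suc n))) (⋆-sum (a ∘ suc) b n))
    (sym (∑-distrib-+ (λ j → a 0 * b j (suc n)) (λ j → ((a ∘ suc) ⋆ b j) n)))

  ⋆-*ʳ : ∀ z a b n → (a ⋆ λ k → b k * z) n ≈ (a ⋆ b) n * z
  ⋆-*ʳ z a b zero    = sym (*-assoc (a 0) (b 0) z)
  ⋆-*ʳ z a b (suc n) = trans
    (+-cong (sym (*-assoc (a 0) (b (suc n)) z)) (⋆-*ʳ z (a ∘ suc) b n))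
    (sym (distribʳ z _ _))

  -- For a = a₀ + X a′ one has D a = a′ + X (D a′) and D (a b) = a₀ (D b) + a′ b + X D (a′ b); the
  -- induction applies the rule to a′.
  leibniz : ∀ a b n → D (a ⋆ b) n ≈ (D a ⋆ b) n + (a ⋆ D b) n
  leibniz a b zero =
    solve 4 (λ a₀ a₁ b₀ b₁ → (con 1 :+ con 0) :* (a₀ :* b₁ :+ a₁ :* b₀) :=
      ((con 1 :+ con 0) :* a₁) :* b₀ :+ a₀ :* ((con 1 :+ con 0) :* b₁)) refl
      (a 0) (a 1) (b 0) (b 1)
  leibniz a b (suc n) = begin
    D (a ⋆ b) (suc n)
      ≈⟨ solve 4 (λ x y z u → (con 1 :+ u) :* (x :* y :+ z) :=
           (x :* ((con 1 :+ u) :* y) :+ z) :+ u :* z) refl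
           (a 0) (b (suc (suc n))) ((a′ ⋆ b) (suc n)) (ν (suc n)) ⟩
    (a 0 * D b (suc n) + (a′ ⋆ b) (suc n)) + D (a′ ⋆ b) n
      ≈⟨ +-congˡ (leibniz a′ b n) ⟩
    (a 0 * D b (suc n) + (a 1 * b (suc n) + (a″ ⋆ b) n)) + ((D a′ ⋆ b) n + (a′ ⋆ D b) n)
      ≈⟨ solve 6 (λ x y z u v w → (x :+ (y :* z :+ u)) :+ (v :+ w) :=
           ((con 1 :+ con 0) :* y :* z :+ (u :+ v)) :+ (x :+ w)) refl
           (a 0 * D b (suc n)) (a 1) (b (suc n)) ((a″ ⋆ b) n) ((D a′ ⋆ b) n) ((a′ ⋆ D b) n) ⟩
    (D a 0 * b (suc n) + ((a″ ⋆ b) n + (D a′ ⋆ b) n)) + (a ⋆ D b) (suc n)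
      -- The sequence `a″` plus `D a′` is the shift of `D a`.
      ≈⟨ +-congʳ (+-congˡ (trans (sym (⋆-distribʳ-+ a″ (D a′) b n))
           (⋆-cong (λ k → solve 2 (λ x u → x :+ u :* x := (con 1 :+ u) :* x) refl
                            (a (suc (suc k))) (ν (suc k)))
                   (λ _ → refl) n))) ⟩
    (D a ⋆ b) (suc n) + (a ⋆ D b) (suc n) ∎
    where
    a′ a″ : ℕ → Carrier
    a′ = a ∘ suc
    a″ = a′ ∘ suc

-- Finite sums and matrices over a commutative ring.

module MatrixAlgebra {c ℓ} (R : CommutativeRing c ℓ) where
  open CommutativeRing R hiding (zero)
  open LinearAlgebra R hiding (sum)
  open Algebra.Properties.Semiring.Sum semiring
    using (sum; sum-cong-≋; sum-replicate-zero; ∑-distrib-+; ∑-comm; *-distribˡ-sum; *-distribʳ-sum)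
  open Relation.Binary.Reasoning.Setoid setoid

  *-leftComm : ∀ x y z → x * (y * z) ≈ y * (x * z)
  *-leftComm x y z = trans (sym (*-assoc x y z)) (trans (*-congʳ (*-comm x y)) (*-assoc y x z))

  sum-zero : ∀ {n} {v : Vector Carrier n} → v ≈ᵥ 0ᵥ → sum v ≈ 0#
  sum-zero {n} e = trans (sum-cong-≋ e) (sum-replicate-zero n)

  sum-++ : ∀ {m n} (f : Vector Carrier (m ℕ.+ n)) →
           sum f ≈ sum (λ i → f (i ↑ˡ n)) + sum (λ i → f (m ↑ʳ i))
  sum-++ {zero}  f = sym (+-identityˡ (sum f))
  sum-++ {suc m} f = trans (+-congˡ (sum-++ {m} (f ∘ suc))) (sym (+-assoc (f zero) _ _))

  sum-1ₘ : ∀ {n} (v : Vector Carrier n) i → 1ₘ i ∙ v ≈ v i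
  sum-1ₘ {suc n} v zero = trans (+-cong (*-identityˡ (v zero)) (sum-zero λ j → zeroˡ (v (suc j))))
    (+-identityʳ (v zero))
  sum-1ₘ {suc n} v (suc i) = trans (+-cong (zeroˡ (v zero)) (sum-1ₘ (v ∘ suc) i))
    (+-identityˡ (v (suc i)))

  *ᵥ-congˡ : ∀ {m n} (A : Matrix m n) {v w} → v ≈ᵥ w → A *ᵥ v ≈ᵥ A *ᵥ w
  *ᵥ-congˡ A e i = sum-cong-≋ λ j → *-congˡ (e j)

  *ᵥ-distribˡ : ∀ {m n} (A : Matrix m n) v w i →
                (A *ᵥ λ j → v j + w j) i ≈ (A *ᵥ v) i + (A *ᵥ w) i
  *ᵥ-distribˡ A v w i = trans (sum-cong-≋ λ j → distribˡ (A i j) (v j) (w j))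
    (∑-distrib-+ (λ j → A i j * v j) (λ j → A i j * w j))

  *ᵥ-·ᵥ : ∀ {m n} (A : Matrix m n) k v i → (A *ᵥ (k ·ᵥ v)) i ≈ k * (A *ᵥ v) i
  *ᵥ-·ᵥ A k v i = trans (sum-cong-≋ λ j → *-leftComm (A i j) k (v j))
    (sym (*-distribˡ-sum k (λ j → A i j * v j)))

  ⊗-*ᵥ : ∀ {l m n} (A : Matrix l m) (B : Matrix m n) v → A ⊗ B *ᵥ v ≈ᵥ A *ᵥ (B *ᵥ v)
  ⊗-*ᵥ A B v i = begin
    sum (λ j → sum (λ k → A i k * B k j) * v j)
      ≈⟨ sum-cong-≋ (λ j → *-distribʳ-sum (v j) (λ k → A i k * B k j)) ⟩
    sum (λ j → sum λ k → A i k * B k j * v j)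
      ≈⟨ ∑-comm (λ j k → A i k * B k j * v j) ⟩
    sum (λ k → sum λ j → A i k * B k j * v j)
      ≈⟨ sum-cong-≋ (λ k → sum-cong-≋ λ j → *-assoc (A i k) (B k j) (v j)) ⟩
    sum (λ k → sum λ j → A i k * (B k j * v j))
      ≈⟨ sum-cong-≋ (λ k → sym (*-distribˡ-sum (A i k) (λ j → B k j * v j))) ⟩
    sum (λ k → A i k * sum λ j → B k j * v j) ∎

  -- Powers grow on the left by definition. The induction needs the new factor next to the vector,
  -- since the intertwining describes `A` applied to `y ++ 0ᵥ`, not powers of `A`.
  ^ₘ-suc-*ᵥ : ∀ {n} (A : Matrix n n) k v → A ^ₘ suc k *ᵥ v ≈ᵥ A ^ₘ k *ᵥ (A *ᵥ v)
  ^ₘ-suc-*ᵥ A zero v i = trans (⊗-*ᵥ A 1ₘ v i)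
    (trans (*ᵥ-congˡ A (sum-1ₘ v) i) (sym (sum-1ₘ (A *ᵥ v) i)))
  ^ₘ-suc-*ᵥ A (suc k) v i = trans (⊗-*ᵥ A (A ^ₘ suc k) v i)
    (trans (*ᵥ-congˡ A (^ₘ-suc-*ᵥ A k v) i) (sym (⊗-*ᵥ A (A ^ₘ k) (A *ᵥ v) i)))

  *ᵥ-++-0ᵥ : ∀ {l m n} (A : Matrix l (m ℕ.+ n)) (v : Vector Carrier m) i →
             (A *ᵥ (v ++ 0ᵥ {n})) i ≈ sum λ j → A i (j ↑ˡ n) * v j
  *ᵥ-++-0ᵥ {m = m} {n} A v i = trans (sum-++ {m} λ j → A i j * (v ++ 0ᵥ {n}) j)
    (trans (+-cong
      (sum-cong-≋ λ j → *-congˡ (reflexive (≡.cong [ v , 0ᵥ ] (Fin.splitAt-↑ˡ m j n))))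
      (sum-zero λ j → trans
        (*-congˡ (reflexive (≡.cong [ v , 0ᵥ ] (Fin.splitAt-↑ʳ m n j))))
        (zeroʳ (A i (m ↑ʳ j)))))
    (+-identityʳ _))

-- Exponential series coefficient by coefficient.

module Exponential {c ℓ} (R : CommutativeRing c ℓ) where
  open CommutativeRing R hiding (zero)
  open Convolution R using (_⋆_; ν; D; ⋆-cong; ⋆-*ˡ; leibniz)
  open LinearAlgebra R hiding (sum)
  open MatrixAlgebra R
  open Algebra.Properties.Semiring.Exp semiring using (_^_)
  open Relation.Binary.Reasoning.Setoid setoid

  -- ρ k stands for 1 / k!.
  module Series (ρ : ℕ → Carrier) (ρ-zero : ρ 0 ≈ 1#) (ρ-suc : ∀ k → ν (suc k) * ρ (suc k) ≈ ρ k)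
    (cancel : ∀ k {x y} → ν (suc k) * x ≈ ν (suc k) * y → x ≈ y)
    where

    D-ρ : ∀ k x → ν (suc k) * (ρ (suc k) * x) ≈ ρ k * x
    D-ρ k x = trans (sym (*-assoc (ν (suc k)) (ρ (suc k)) x)) (*-congʳ (ρ-suc k))

    expTerm : Carrier → ℕ → Carrier
    expTerm ζ k = ρ k * ζ ^ k

    D-expTerm : ∀ ζ k → D (expTerm ζ) k ≈ ζ * expTerm ζ k
    D-expTerm ζ k = trans (D-ρ k (ζ * ζ ^ k)) (*-leftComm (ρ k) ζ (ζ ^ k))

    expTermₘ : ∀ {n} → Matrix n n → Vector Carrier n → Fin n → ℕ → Carrier
    expTermₘ A v i k = ρ k * (A ^ₘ k *ᵥ v) i

    expTermₘ-cong : ∀ {n} (A : Matrix n n) {v w} → v ≈ᵥ w → ∀ i k → expTermₘ A v i k ≈ expTermₘ A w i k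
    expTermₘ-cong A e i k = *-congˡ (*ᵥ-congˡ (A ^ₘ k) e i)

    D-expTermₘ : ∀ {n} (A : Matrix n n) v i k → D (expTermₘ A v i) k ≈ expTermₘ A (A *ᵥ v) i k
    D-expTermₘ A v i k = trans (D-ρ k _) (*-congˡ (^ₘ-suc-*ᵥ A k v i))

    module _ {c m} (A : Matrix (c ℕ.+ m) (c ℕ.+ m)) (B : Matrix c c) (ζ : Carrier)
      {p} (W : Vector Carrier c → Set p) (W-invariant : ∀ {y} → W y → W (B *ᵥ y))
      (intertwines : ∀ {y} → W y →
        A *ᵥ (y ++ 0ᵥ {m}) ≈ᵥ (λ i → (B *ᵥ y ++ 0ᵥ {m}) i + ζ * (y ++ 0ᵥ {m}) i))
      where

      private
        -- The coefficients in X of e^(ζX) e^(XB) y, extended by zero outside the first `c` entries.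
        F : Vector Carrier c → Fin (c ℕ.+ m) → ℕ → Carrier
        F y i k = ((λ j → (expTerm ζ ⋆ expTermₘ B y j) k) ++ 0ᵥ {m}) i

      F-zero : ∀ y i → (y ++ 0ᵥ {m}) i ≈ F y i 0
      F-zero y i with splitAt c i
      ... | inj₂ _ = refl
      ... | inj₁ j = sym (begin
        ρ 0 * 1# * (ρ 0 * (1ₘ *ᵥ y) j)
          ≈⟨ *-cong (*-congʳ ρ-zero) (*-cong ρ-zero (sum-1ₘ y j)) ⟩
        1# * 1# * (1# * y j)
          ≈⟨ *-cong (*-identityˡ 1#) (*-identityˡ (y j)) ⟩
        1# * y j
          ≈⟨ *-identityˡ (y j) ⟩
        y j ∎)

      D-F : ∀ y i k → D (F y i) k ≈ F (B *ᵥ y) i k + ζ * F y i k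
      D-F y i k with splitAt c i
      ... | inj₂ _ = trans (zeroʳ (ν (suc k))) (sym (trans (+-identityˡ (ζ * 0#)) (zeroʳ ζ)))
      ... | inj₁ j = begin
        D (expTerm ζ ⋆ expTermₘ B y j) k
          ≈⟨ leibniz (expTerm ζ) (expTermₘ B y j) k ⟩
        (D (expTerm ζ) ⋆ expTermₘ B y j) k + (expTerm ζ ⋆ D (expTermₘ B y j)) k
          ≈⟨ +-cong (trans (⋆-cong (D-expTerm ζ) (λ _ → refl) k) (⋆-*ˡ ζ (expTerm ζ) (expTermₘ B y j) k))
                    (⋆-cong (λ _ → refl) (D-expTermₘ B y j) k) ⟩
        ζ * (expTerm ζ ⋆ expTermₘ B y j) k + (expTerm ζ ⋆ expTermₘ B (B *ᵥ y) j) k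
          ≈⟨ +-comm _ _ ⟩
        (expTerm ζ ⋆ expTermₘ B (B *ᵥ y) j) k + ζ * (expTerm ζ ⋆ expTermₘ B y j) k ∎

      -- Both sides, as sequences in k, have the same initial term and solve the
      -- same differential equation D f = f (B *ᵥ y) + ζ f.
      expTermₘ-⋆ : ∀ k {y} → W y → ∀ i →
        expTermₘ A (y ++ 0ᵥ {m}) i k ≈ ((λ j → (expTerm ζ ⋆ expTermₘ B y j) k) ++ 0ᵥ {m}) i
      expTermₘ-⋆ zero {y} w i = trans (*-cong ρ-zero (sum-1ₘ (y ++ 0ᵥ {m}) i))
        (trans (*-identityˡ _) (F-zero y i))
      expTermₘ-⋆ (suc k) {y} w i = cancel k (begin
        D (expTermₘ A ŷ i) k
          ≈⟨ D-expTermₘ A ŷ i k ⟩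
        expTermₘ A (A *ᵥ ŷ) i k
          ≈⟨ expTermₘ-cong A (intertwines w) i k ⟩
        expTermₘ A (λ j → B̂y j + ζ * ŷ j) i k
          ≈⟨ *-congˡ (trans (*ᵥ-distribˡ (A ^ₘ k) B̂y (ζ ·ᵥ ŷ) i) (+-congˡ (*ᵥ-·ᵥ (A ^ₘ k) ζ ŷ i))) ⟩
        ρ k * ((A ^ₘ k *ᵥ B̂y) i + ζ * (A ^ₘ k *ᵥ ŷ) i)
          ≈⟨ trans (distribˡ (ρ k) _ _) (+-congˡ (*-leftComm (ρ k) ζ _)) ⟩
        expTermₘ A B̂y i k + ζ * expTermₘ A ŷ i k
          -- The induction hypothesis is used at two vectors, `B *ᵥ y` and `y`; the first is
          -- admissible because W is invariant.
          ≈⟨ +-cong (expTermₘ-⋆ k (W-invariant w) i) (*-congˡ (expTermₘ-⋆ k w i)) ⟩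
        F (B *ᵥ y) i k + ζ * F y i k
          ≈⟨ sym (D-F y i k) ⟩
        D (F y i) k ∎)
        where
        ŷ B̂y : Vector Carrier (c ℕ.+ m)
        ŷ = y ++ 0ᵥ {m}
        B̂y = B *ᵥ y ++ 0ᵥ {m}

-- The Cauchy product of two dominated complex series.

infix 4 _≼ᶜ_

_≼ᶜ_ : ℂ → ℚ → Set
z ≼ᶜ q = re z ≼ q × im z ≼ q

≼ᶜ-resp : ∀ {z w q} → z ≈ᶜ w → z ≼ᶜ q → w ≼ᶜ q
≼ᶜ-resp (e , f) (h , k) = ≼-resp e h , ≼-resp f k

≼ᶜ-+ : ∀ {z w p q} → z ≼ᶜ p → w ≼ᶜ q → z +ᶜ w ≼ᶜ p ℚ.+ q
≼ᶜ-+ (h , k) (h′ , k′) = ≼-+ h h′ , ≼-+ k k′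

-- Real and imaginary parts are bounded separately, and each part of a product combines two real
-- products; hence the doubled bound.
≼ᶜ-*-bounded : ∀ {z w p q} → 0ℚ ℚ.< q → z ≼ᶜ p → Boundedᶜ w q → z *ᶜ w ≼ᶜ p ℚ.* q ℚ.+ p ℚ.* q
≼ᶜ-*-bounded {w = w} 0<q (h , k) (h′ , k′) =
    ≼-+ (≼-*-bounded {y = re w} 0<q h h′) (≼-neg (≼-*-bounded {y = im w} 0<q k k′))
  , ≼-+ (≼-*-bounded {y = im w} 0<q h k′) (≼-*-bounded {y = re w} 0<q k h′)

boundedᶜ⇒≼ᶜ : ∀ {z q} → Boundedᶜ z q → z ≼ᶜ q
boundedᶜ⇒≼ᶜ {z} (h , k) = bounded⇒≼ {re z} h , bounded⇒≼ {im z} k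

¼ : ℚ
¼ = ℤ.+ 1 ℚ./ 4

2⁻ 4⁻ : ℕ → ℚ
2⁻ k = recip (2 ℕ.^ k) {{ℕ.m^n≢0 2 k}}
4⁻ k = recip (4 ℕ.^ k) {{ℕ.m^n≢0 4 k}}

recip-^-suc : ∀ b k .{{_ : ℕ.NonZero b}} →
  fromℕ b ℚ.* recip (b ℕ.^ suc k) {{ℕ.m^n≢0 b (suc k)}} ≡ recip (b ℕ.^ k) {{ℕ.m^n≢0 b k}}
recip-^-suc b k = ≡.trans
  (frac-≡ b (b ℕ.^ suc k) 1 (b ℕ.^ k) {{ℕ.m^n≢0 b (suc k)}} {{ℕ.m^n≢0 b k}}
    (≡.sym (ℕ.*-identityˡ (b ℕ.^ suc k))))
  (≡.trans (≡.cong (ℚ._* recip (b ℕ.^ k) {{ℕ.m^n≢0 b k}}) fromℕ-1) (ℚ.*-identityˡ _))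

2⁻-suc : ∀ k → 2⁻ (suc k) ≡ ½ ℚ.* 2⁻ k
2⁻-suc k = ≡.trans (≡.trans (≡.sym (ℚ.*-identityˡ (2⁻ (suc k)))) (ℚ.*-assoc ½ (1ℚ ℚ.+ 1ℚ) (2⁻ (suc k))))
  (≡.cong (½ ℚ.*_) (≡.trans (≡.cong (ℚ._* 2⁻ (suc k)) (≡.sym two)) (recip-^-suc 2 k)))
  where
  two : fromℕ 2 ≡ 1ℚ ℚ.+ 1ℚ
  two = ≡.trans (fromℕ-suc 1) (≡.cong (1ℚ ℚ.+_) fromℕ-1)

4⁻-suc : ∀ k → 4⁻ (suc k) ≡ ¼ ℚ.* 4⁻ k
4⁻-suc k = ≡.trans (≡.trans (≡.sym (ℚ.*-identityˡ (4⁻ (suc k)))) (ℚ.*-assoc ¼ 4ℚ (4⁻ (suc k))))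
  (≡.cong (¼ ℚ.*_) (≡.trans (≡.cong (ℚ._* 4⁻ (suc k)) (≡.sym four)) (recip-^-suc 4 k)))
  where
  4ℚ : ℚ
  4ℚ = ℤ.+ 4 ℚ./ 1
  four : fromℕ 4 ≡ 4ℚ
  four = ≡.trans (fromℕ-suc 3) (≡.cong (1ℚ ℚ.+_) (≡.trans (fromℕ-suc 2)
    (≡.cong (1ℚ ℚ.+_) (≡.trans (fromℕ-suc 1) (≡.cong (1ℚ ℚ.+_) fromℕ-1)))))

0<2⁻ : ∀ k → 0ℚ ℚ.< 2⁻ k
0<2⁻ k = 0<recip (2 ℕ.^ k) {{ℕ.m^n≢0 2 k}}

n<2^n : ∀ n → n ℕ.< 2 ℕ.^ n
n<2^n zero = ℕ.s≤s ℕ.z≤n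
n<2^n (suc n) = ℕ.+-mono-≤-< (ℕ.m^n>0 2 n) (ℕ.<-≤-trans (n<2^n n) (ℕ.m≤m+n (2 ℕ.^ n) 0))

2⁻≤unit : ∀ n → 2⁻ n ℚ.≤ unit n
2⁻≤unit n = ≡.subst₂ ℚ._≤_ (one (2⁻ n)) (one (unit n))
  (frac-≤ 1 (2 ℕ.^ n) 1 (suc n) {{ℕ.m^n≢0 2 n}} (ℕ.*-monoʳ-≤ 1 (n<2^n n)))
  where
  one : ∀ p → fromℕ 1 ℚ.* p ≡ p
  one p = ≡.trans (≡.cong (ℚ._* p) fromℕ-1) (ℚ.*-identityˡ p)

0<* : ∀ {p q} → 0ℚ ℚ.< p → 0ℚ ℚ.< q → 0ℚ ℚ.< p ℚ.* q
0<* {p} {q} 0<p 0<q = ℚ.positive⁻¹ (p ℚ.* q) {{ℚ.pos*pos⇒pos p {{ℚ.positive 0<p}} q {{ℚ.positive 0<q}}}}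

geometric-null : ∀ {a K} → 0ℚ ℚ.< K → (∀ n → a n ≼ K ℚ.* 2⁻ n) → Null a
geometric-null {a} {K} 0<K h ε 0<ε =
  let θ , 0<θ , e = divide 0<K 0<ε
      N , u≤θ = unit-≤ θ 0<θ
  in N , λ n N≤n → ≼-weaken
    (≡.subst (K ℚ.* 2⁻ n ℚ.≤_) e (ℚ.*-monoˡ-≤-nonNeg K {{ℚ.nonNegative (ℚ.<⇒≤ 0<K)}}
      (ℚ.≤-trans (2⁻≤unit n) (ℚ.≤-trans (unit-antitone N≤n) u≤θ))))
    (h n)

module ℂ-Solver = Algebra.Solver.Ring.NaturalCoefficients.Default
  (CommutativeRing.commutativeSemiring ℂ-commutativeRing)

module ℂ-Convolution = Convolution ℂ-commutativeRing
open ℂ-Convolution using (_⋆_; ν)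

partialSum-cong : ∀ {a b} → (∀ k → a k ≈ᶜ b k) → ∀ n → partialSum a n ≈ᶜ partialSum b n
partialSum-cong e zero    = C.refl
partialSum-cong e (suc n) = C.+-cong (partialSum-cong e n) (e n)

partialSum-0ᶜ : ∀ n → partialSum (λ _ → 0ᶜ) n ≈ᶜ 0ᶜ
partialSum-0ᶜ zero    = C.refl
partialSum-0ᶜ (suc n) = C.trans (C.+-identityʳ _) (partialSum-0ᶜ n)

partialSum-*ʳ : ∀ a z n → partialSum (λ k → a k *ᶜ z) n ≈ᶜ partialSum a n *ᶜ z
partialSum-*ʳ a z zero    = C.sym (C.zeroˡ z)
partialSum-*ʳ a z (suc n) = C.trans (C.+-congʳ (partialSum-*ʳ a z n))
  (C.sym (C.distribʳ z (partialSum a n) (a n)))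

partialSum-suc : ∀ a n → partialSum a (suc n) ≈ᶜ a 0 +ᶜ partialSum (a ∘ suc) n
partialSum-suc a zero    = C.+-comm 0ᶜ (a 0)
partialSum-suc a (suc n) = C.trans (C.+-congʳ (partialSum-suc a n))
  (C.+-assoc (a 0) (partialSum (a ∘ suc) n) (a (suc n)))

partialSum-⋆-suc : ∀ a b n → partialSum (a ⋆ b) (suc n) ≈ᶜ
                   a 0 *ᶜ partialSum b (suc n) +ᶜ partialSum ((a ∘ suc) ⋆ b) n
partialSum-⋆-suc a b zero =
  solve 2 (λ x y → con 0 :+ x :* y := x :* (con 0 :+ y) :+ con 0) C.refl (a 0) (b 0)
  where open ℂ-Solver
partialSum-⋆-suc a b (suc n) = C.trans (C.+-congʳ (partialSum-⋆-suc a b n))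
  (solve 5 (λ x s p y c → (x :* s :+ p) :+ (x :* y :+ c) := x :* (s :+ y) :+ (p :+ c)) C.refl
    (a 0) (partialSum b (suc n)) (partialSum ((a ∘ suc) ⋆ b) n) (b (suc n)) (((a ∘ suc) ⋆ b) n))
  where open ℂ-Solver

-- The sum of `a i *ᶜ b j` over i, j < n with i + j ≥ n, that is, the square of index pairs minus
-- the triangle i + j < n. The recursion separates the row j = n and shifts i in the rest, where i =
-- 0 cannot occur.
⋆-remainder : (ℕ → ℂ) → (ℕ → ℂ) → ℕ → ℂ
⋆-remainder a b zero    = 0ᶜ
⋆-remainder a b (suc n) = ⋆-remainder (a ∘ suc) b n +ᶜ partialSum (a ∘ suc) n *ᶜ b n

partialSum-* : ∀ a b n → partialSum a n *ᶜ partialSum b n ≈ᶜ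
               partialSum (a ⋆ b) n +ᶜ ⋆-remainder a b n
partialSum-* a b zero = C.trans (C.zeroˡ 0ᶜ) (C.sym (C.+-identityʳ 0ᶜ))
partialSum-* a b (suc n) = C.trans (C.*-congʳ (partialSum-suc a n))
  (C.trans (solve 4 (λ x p q y → (x :+ p) :* (q :+ y) := x :* (q :+ y) :+ (p :* q :+ p :* y)) C.refl
      (a 0) (partialSum (a ∘ suc) n) (partialSum b n) (b n))
    (C.trans (C.+-congˡ (C.+-congʳ (partialSum-* (a ∘ suc) b n)))
      (C.trans (solve 4 (λ u v w x → u :+ ((v :+ w) :+ x) := (u :+ v) :+ (w :+ x)) C.refl
          (a 0 *ᶜ partialSum b (suc n)) (partialSum ((a ∘ suc) ⋆ b) n)
          (⋆-remainder (a ∘ suc) b n) (partialSum (a ∘ suc) n *ᶜ b n))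
        (C.+-congʳ (C.sym (partialSum-⋆-suc a b n))))))
  where open ℂ-Solver

-- The terms of a are dominated by 4⁻ and not merely by 2⁻: shifting a then divides the
-- bound on the remainder by 4, whereas 2⁻ only halves, which leaves room for the new
-- summand. The constants are 4/3 = Σ 4⁻ k and the solution 8/3 of
-- x / 4 + 2 · (4/3) / 4 = x / 2.
module _ where
  open +-*-Solver

  4/3 8/3 : ℚ
  4/3 = ℤ.+ 4 ℚ./ 3
  8/3 = ℤ.+ 8 ℚ./ 3

  0≤*¼ : ∀ {A} → 0ℚ ℚ.≤ A → 0ℚ ℚ.≤ A ℚ.* ¼
  0≤*¼ {A} h = ≡.subst (ℚ._≤ A ℚ.* ¼) (ℚ.*-zeroˡ ¼) (ℚ.*-monoʳ-≤-nonNeg ¼ h)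

  0≤* : ∀ {p q} → 0ℚ ℚ.≤ p → 0ℚ ℚ.≤ q → 0ℚ ℚ.≤ p ℚ.* q
  0≤* {p} {q} h k = ≡.subst (ℚ._≤ p ℚ.* q) (ℚ.*-zeroˡ q) (ℚ.*-monoʳ-≤-nonNeg q {{ℚ.nonNegative k}} h)

  shift-≼ᶜ : ∀ (a : ℕ → ℂ) A → (∀ k → a k ≼ᶜ A ℚ.* 4⁻ k) → ∀ k → a (suc k) ≼ᶜ A ℚ.* ¼ ℚ.* 4⁻ k
  shift-≼ᶜ a A h k = ≡.subst (a (suc k) ≼ᶜ_)
    (≡.trans (≡.cong (A ℚ.*_) (4⁻-suc k)) (≡.sym (ℚ.*-assoc A ¼ (4⁻ k)))) (h (suc k))

  partialSum-≼ᶜ : ∀ {a A} → 0ℚ ℚ.≤ A → (∀ k → a k ≼ᶜ A ℚ.* 4⁻ k) →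
                  ∀ n → partialSum a n ≼ᶜ 4/3 ℚ.* A
  partialSum-≼ᶜ {a} {A} 0≤A h zero = ≼-0 0≤ , ≼-0 0≤
    where
    0≤ : 0ℚ ℚ.≤ 4/3 ℚ.* A
    0≤ = 0≤* (ℚ.nonNegative⁻¹ 4/3) 0≤A
  partialSum-≼ᶜ {a} {A} 0≤A h (suc n) = ≼ᶜ-resp (C.sym (partialSum-suc a n))
    (≡.subst (a 0 +ᶜ partialSum (a ∘ suc) n ≼ᶜ_)
      (≡.trans (≡.cong (λ g → A ℚ.* g ℚ.+ 4/3 ℚ.* (A ℚ.* ¼)) recip-1)
        (solve 1 (λ A → A :* con 1ℚ :+ con 4/3 :* (A :* con ¼) := con 4/3 :* A) ≡.refl A))
      (≼ᶜ-+ (h 0) (partialSum-≼ᶜ (0≤*¼ 0≤A) (shift-≼ᶜ a A h) n)))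

  ⋆-remainder-≼ᶜ : ∀ {a b A B} → 0ℚ ℚ.≤ A → 0ℚ ℚ.< B →
    (∀ k → a k ≼ᶜ A ℚ.* 4⁻ k) → (∀ k → Boundedᶜ (b k) (B ℚ.* 2⁻ k)) →
    ∀ n → ⋆-remainder a b n ≼ᶜ 8/3 ℚ.* A ℚ.* B ℚ.* 2⁻ n
  ⋆-remainder-≼ᶜ {a} {b} {A} {B} 0≤A 0<B h k zero = ≼-0 0≤ , ≼-0 0≤
    where
    0≤ : 0ℚ ℚ.≤ 8/3 ℚ.* A ℚ.* B ℚ.* 2⁻ 0
    0≤ = 0≤* (0≤* (0≤* (ℚ.nonNegative⁻¹ 8/3) 0≤A) (ℚ.<⇒≤ 0<B)) (ℚ.<⇒≤ (0<2⁻ 0))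
  ⋆-remainder-≼ᶜ {a} {b} {A} {B} 0≤A 0<B h k (suc n) =
    ≡.subst (⋆-remainder a b (suc n) ≼ᶜ_)
      (≡.trans (solve 3 (λ A B h →
          con 8/3 :* (A :* con ¼) :* B :* h :+
            (con 4/3 :* (A :* con ¼) :* (B :* h) :+ con 4/3 :* (A :* con ¼) :* (B :* h))
          := con 8/3 :* A :* B :* (con ½ :* h)) ≡.refl A B (2⁻ n))
        (≡.cong (8/3 ℚ.* A ℚ.* B ℚ.*_) (≡.sym (2⁻-suc n))))
      (≼ᶜ-+ (⋆-remainder-≼ᶜ {a ∘ suc} {b} (0≤*¼ 0≤A) 0<B (shift-≼ᶜ a A h) k n)
            (≼ᶜ-*-bounded {w = b n} (0<* 0<B (0<2⁻ n))
              (partialSum-≼ᶜ (0≤*¼ 0≤A) (shift-≼ᶜ a A h) n) (k n)))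

-- The partial sums of `a ⋆ b` are the products of partial sums minus `⋆-remainder`, which is at
-- most a constant times `2⁻ n`.
cauchy-product : ∀ {a b A B α β} → 0ℚ ℚ.< A → 0ℚ ℚ.< B →
  (∀ k → Boundedᶜ (a k) (A ℚ.* 4⁻ k)) → (∀ k → Boundedᶜ (b k) (B ℚ.* 2⁻ k)) →
  partialSum a ⟶ᶜ α → partialSum b ⟶ᶜ β → partialSum (a ⋆ b) ⟶ᶜ α *ᶜ β
cauchy-product {a} {b} {A} {B} {α} {β} 0<A 0<B ha hb a⟶α b⟶β =
  ⟶ᶜ-cong
    (λ n → C.trans (C.+-congʳ (partialSum-* a b n))
      (C.trans (C.+-assoc (partialSum (a ⋆ b) n) (⋆-remainder a b n) (-ᶜ ⋆-remainder a b n))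
        (C.trans (C.+-congˡ (C.-‿inverseʳ (⋆-remainder a b n))) (C.+-identityʳ (partialSum (a ⋆ b) n)))))
    (C.trans (C.+-congˡ (C.trans (C.sym (C.+-identityˡ (-ᶜ 0ᶜ))) (C.-‿inverseʳ 0ᶜ))) (C.+-identityʳ (α *ᶜ β)))
    (⟶ᶜ-+ (⟶ᶜ-* a⟶α b⟶β) (⟶-neg (to-zero (proj₁ ∘ small)) , ⟶-neg (to-zero (proj₂ ∘ small))))
  where
  K : ℚ
  K = 8/3 ℚ.* A ℚ.* B
  small : ∀ n → ⋆-remainder a b n ≼ᶜ K ℚ.* 2⁻ n
  small = ⋆-remainder-≼ᶜ (ℚ.<⇒≤ 0<A) 0<B (λ k → boundedᶜ⇒≼ᶜ {a k} (ha k)) hb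
  to-zero : ∀ {x} → (∀ n → x n ≼ K ℚ.* 2⁻ n) → x ⟶ 0ᴿ
  to-zero {x} h = null-cong (λ n → ≡⇒≃ λ i → ≡.sym (ℚ.+-identityʳ (approx (x n) i)))
    (geometric-null (0<* (0<* (ℚ.positive⁻¹ 8/3) 0<A) 0<B) h)

-- With E = (dq + 1)^(dq + 1), `power≤factorial` gives (dq)^k ≤ E k!, hence q^k / k! ≤ E / d^k. The
-- base d is free because the two factors of `cauchy-product` need 4 and 2.
/!-bounded : ∀ d q → .{{_ : ℕ.NonZero d}} → ∀ k {z} → Boundedᶜ z (fromℕ (q ℕ.^ k)) →
  Boundedᶜ (z /! k)
    (fromℕ (suc (d ℕ.* q) ℕ.^ suc (d ℕ.* q)) ℚ.* recip (d ℕ.^ k) {{ℕ.m^n≢0 d k}})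
/!-bounded d q k {z} (h , h′) =
    bounded (re z) (re (z /! k)) h (λ i → solve 3 (λ r x y → r :* x :- con 0ℚ :* y := r :* x) ≡.refl
      r (approx (re z) i) (approx (im z) i))
  , bounded (im z) (im (z /! k)) h′ (λ i → solve 3 (λ r x y → r :* y :+ con 0ℚ :* x := r :* y) ≡.refl
      r (approx (re z) i) (approx (im z) i))
  where
  open +-*-Solver
  r : ℚ
  r = recip (k !) {{k ℕ.!≢0}}
  E : ℕ
  E = suc (d ℕ.* q) ℕ.^ suc (d ℕ.* q)
  0≤r : 0ℚ ℚ.≤ r
  0≤r = ℚ.<⇒≤ (0<recip (k !) {{k ℕ.!≢0}})
  domination : r ℚ.* fromℕ (q ℕ.^ k) ℚ.≤ fromℕ E ℚ.* recip (d ℕ.^ k) {{ℕ.m^n≢0 d k}}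
  domination = ≡.subst (ℚ._≤ fromℕ E ℚ.* recip (d ℕ.^ k) {{ℕ.m^n≢0 d k}}) (ℚ.*-comm (fromℕ (q ℕ.^ k)) r)
    (frac-≤ (q ℕ.^ k) (k !) E (d ℕ.^ k) {{k ℕ.!≢0}} {{ℕ.m^n≢0 d k}}
      (ℕ.≤-trans (ℕ.≤-reflexive (≡.trans (ℕ.*-comm (q ℕ.^ k) (d ℕ.^ k)) (≡.sym (*-^-distrib d q k))))
        (ℕ.≤-trans (ℕ.^-monoˡ-≤ k (ℕ.n≤1+n (d ℕ.* q))) (power≤factorial (d ℕ.* q) k))))
  bounded : ∀ x y → Bounded x (fromℕ (q ℕ.^ k)) → (∀ i → approx y i ≡ r ℚ.* approx x i) →
            Bounded y (fromℕ E ℚ.* recip (d ℕ.^ k) {{ℕ.m^n≢0 d k}})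
  bounded x y h e = eventually-map (λ i b → ℚ.≤-trans
    (ℚ.≤-reflexive (≡.trans (≡.cong ℚ.∣_∣ (e i)) (≡.trans (ℚ.∣p*q∣≡∣p∣*∣q∣ r (approx x i))
      (≡.cong (ℚ._* ℚ.∣ approx x i ∣) (ℚ.0≤p⇒∣p∣≡p 0≤r)))))
    (ℚ.≤-trans (ℚ.*-monoˡ-≤-nonNeg r {{ℚ.nonNegative 0≤r}} b) domination)) h

0<fromℕ-^ : ∀ m n → 0ℚ ℚ.< fromℕ (suc m ℕ.^ n)
0<fromℕ-^ m n = ℚ.<-≤-trans (0<fromℕ 0) (fromℕ-mono-≤ (ℕ.m^n>0 (suc m) n))

-- Block matrices acting on vectors of coordinate sum zero.

↑-elim : ∀ {c m p} (P : Fin (c ℕ.+ m) → Set p) → (∀ a → P (a ↑ˡ m)) → (∀ b → P (c ↑ʳ b)) → ∀ i → P i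
↑-elim {c} P l r i with splitAt c i in eq
... | inj₁ a = ≡.subst P (Fin.splitAt⁻¹-↑ˡ eq) (l a)
... | inj₂ b = ≡.subst P (Fin.splitAt⁻¹-↑ʳ eq) (r b)

module Intertwining {c ℓ} (R : CommutativeRing c ℓ) where
  open CommutativeRing R hiding (zero)
  open LinearAlgebra R hiding (sum)
  open MatrixAlgebra R
  open Algebra.Properties.Semiring.Sum semiring
    using (sum; sum-cong-≋; ∑-distrib-+; ∑-comm; *-distribˡ-sum; *-distribʳ-sum)
  open Relation.Binary.Reasoning.Setoid setoid

  Balanced : ∀ {n} → Vector Carrier n → Set ℓ
  Balanced y = sum y ≈ 0#

  -- Constant column sums mean 1ᵀB = μ1ᵀ, so 1ᵀBy = μ1ᵀy.
  *ᵥ-balanced : ∀ {n} (B : Matrix n n) μ → (∀ j → sum (λ i → B i j) ≈ μ) →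
                ∀ {y : Vector Carrier n} → Balanced y → Balanced (B *ᵥ y)
  *ᵥ-balanced B μ col {y} e = begin
    sum (λ i → sum λ j → B i j * y j)
      ≈⟨ ∑-comm (λ i j → B i j * y j) ⟩
    sum (λ j → sum λ i → B i j * y j)
      ≈⟨ sum-cong-≋ (λ j → trans (sym (*-distribʳ-sum (y j) (λ i → B i j))) (*-congʳ (col j))) ⟩
    sum (λ j → μ * y j)
      ≈⟨ sym (*-distribˡ-sum μ y) ⟩
    μ * sum y
      ≈⟨ trans (*-congˡ e) (zeroʳ μ) ⟩
    0# ∎

  -- Only the first `c` columns of `A` meet `y ++ 0ᵥ`. In the lower block they are equal, so an
  -- entry there is `w p * sum y`, which vanishes.
  block-intertwines : ∀ {c m} (A : Matrix (c ℕ.+ m) (c ℕ.+ m)) (B : Matrix c c) ζ (w : Vector Carrier m) →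
    (∀ a b → A (a ↑ˡ m) (b ↑ˡ m) ≈ B a b + ζ * 1ₘ a b) →
    (∀ p b → A (c ↑ʳ p) (b ↑ˡ m) ≈ w p) →
    ∀ {y : Vector Carrier c} → Balanced y →
    A *ᵥ (y ++ 0ᵥ {m}) ≈ᵥ (λ i → (B *ᵥ y ++ 0ᵥ {m}) i + ζ * (y ++ 0ᵥ {m}) i)
  block-intertwines {c} {m} A B ζ w upper lower {y} e = ↑-elim {c} _ left right
    where
    RHS : Fin c ⊎ Fin m → Carrier
    RHS p = [ B *ᵥ y , 0ᵥ ] p + ζ * [ y , 0ᵥ ] p

    left : ∀ a → (A *ᵥ (y ++ 0ᵥ {m})) (a ↑ˡ m) ≈ RHS (splitAt c (a ↑ˡ m))
    left a = begin
      (A *ᵥ (y ++ 0ᵥ {m})) (a ↑ˡ m)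
        ≈⟨ *ᵥ-++-0ᵥ A y (a ↑ˡ m) ⟩
      sum (λ b → A (a ↑ˡ m) (b ↑ˡ m) * y b)
        ≈⟨ sum-cong-≋ (λ b → trans (*-congʳ (upper a b))
             (trans (distribʳ (y b) (B a b) _) (+-congˡ (*-assoc ζ (1ₘ a b) (y b))))) ⟩
      sum (λ b → B a b * y b + ζ * (1ₘ a b * y b))
        ≈⟨ ∑-distrib-+ (λ b → B a b * y b) (λ b → ζ * (1ₘ a b * y b)) ⟩
      (B *ᵥ y) a + sum (λ b → ζ * (1ₘ a b * y b))
        ≈⟨ +-congˡ (trans (sym (*-distribˡ-sum ζ (λ b → 1ₘ a b * y b))) (*-congˡ (sum-1ₘ y a))) ⟩
      (B *ᵥ y) a + ζ * y a
        ≈⟨ reflexive (≡.cong RHS (≡.sym (Fin.splitAt-↑ˡ c a m))) ⟩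
      RHS (splitAt c (a ↑ˡ m)) ∎

    right : ∀ p → (A *ᵥ (y ++ 0ᵥ {m})) (c ↑ʳ p) ≈ RHS (splitAt c (c ↑ʳ p))
    right p = begin
      (A *ᵥ (y ++ 0ᵥ {m})) (c ↑ʳ p)
        ≈⟨ *ᵥ-++-0ᵥ A y (c ↑ʳ p) ⟩
      sum (λ b → A (c ↑ʳ p) (b ↑ˡ m) * y b)
        ≈⟨ sum-cong-≋ (λ b → *-congʳ (lower p b)) ⟩
      sum (λ b → w p * y b)
        ≈⟨ sym (*-distribˡ-sum (w p) y) ⟩
      w p * sum y
        ≈⟨ trans (*-congˡ e) (zeroʳ (w p)) ⟩
      0#
        ≈⟨ sym (trans (+-identityˡ (ζ * 0#)) (zeroʳ ζ)) ⟩
      0# + ζ * 0#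
        ≈⟨ reflexive (≡.cong RHS (≡.sym (Fin.splitAt-↑ʳ c m p))) ⟩
      RHS (splitAt c (c ↑ʳ p)) ∎

-- From coefficients to the complex exponentials.

module ℂ-Sum = Algebra.Properties.Semiring.Sum C.semiring
open Intertwining using (Balanced; *ᵥ-balanced; block-intertwines)

-- This is exactly the scalar inside `_/!_`, so `1/! k *ᶜ z` and `z /! k` agree by definition.
1/!_ : ℕ → ℂ
1/! k = fromℝ (fromℚ (recip (k !) {{k ℕ.!≢0}}))

fromℚᶜ-* : ∀ p q → fromℝ (fromℚ p) *ᶜ fromℝ (fromℚ q) ≈ᶜ fromℝ (fromℚ (p ℚ.* q))
fromℚᶜ-* p q = ≡⇒≃ (λ _ → solve 2 (λ p q → p :* q :- con 0ℚ :* con 0ℚ := p :* q) ≡.refl p q)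
             , ≡⇒≃ (λ _ → solve 2 (λ p q → p :* con 0ℚ :+ con 0ℚ :* q := con 0ℚ) ≡.refl p q)
  where open +-*-Solver

ν-fromℕ : ∀ k → ν k ≈ᶜ fromℝ (fromℚ (fromℕ k))
ν-fromℕ zero    = ≡⇒≃ (λ _ → ≡.sym fromℕ-0) , ≃-refl
ν-fromℕ (suc k) = C.trans (C.+-congˡ {1ᶜ} (ν-fromℕ k))
  (≡⇒≃ (λ _ → ≡.sym (fromℕ-suc k)) , ≡⇒≃ (λ _ → ℚ.+-identityˡ 0ℚ))

ν-* : ∀ k {p q} → fromℕ k ℚ.* p ≡ q → ν k *ᶜ fromℝ (fromℚ p) ≈ᶜ fromℝ (fromℚ q)
ν-* k {p} ≡.refl = C.trans (C.*-congʳ (ν-fromℕ k)) (fromℚᶜ-* (fromℕ k) p)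

1/!-suc : ∀ k → ν (suc k) *ᶜ 1/! suc k ≈ᶜ 1/! k
1/!-suc k = ν-* (suc k) (≡.trans
  (frac-≡ (suc k) (suc k !) 1 (k !) {{suc k ℕ.!≢0}} {{k ℕ.!≢0}} (≡.sym (ℕ.*-identityˡ (suc k !))))
  (≡.trans (≡.cong (ℚ._* recip (k !) {{k ℕ.!≢0}}) fromℕ-1) (ℚ.*-identityˡ _)))

ν-cancel : ∀ k {x y} → ν (suc k) *ᶜ x ≈ᶜ ν (suc k) *ᶜ y → x ≈ᶜ y
ν-cancel k {x} {y} e = C.trans (C.sym (undo x)) (C.trans (C.*-congˡ e) (undo y))
  where
  r : ℂ
  r = fromℝ (fromℚ (unit k))
  inverse : r *ᶜ ν (suc k) ≈ᶜ 1ᶜ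
  inverse = C.trans (C.*-comm r (ν (suc k))) (ν-* (suc k)
    (≡.trans (frac-≡ (suc k) (suc k) 1 1 (ℕ.*-comm (suc k) 1)) (≡.cong₂ ℚ._*_ fromℕ-1 recip-1)))
  undo : ∀ z → r *ᶜ (ν (suc k) *ᶜ z) ≈ᶜ z
  undo z = C.trans (C.sym (C.*-assoc r (ν (suc k)) z)) (C.trans (C.*-congʳ inverse) (C.*-identityˡ z))

1/!-zero : 1/! 0 ≈ᶜ 1ᶜ
1/!-zero = ≡⇒≃ (λ _ → recip-1) , ≃-refl

open Exponential.Series ℂ-commutativeRing 1/!_ 1/!-zero 1/!-suc ν-cancel
  using (expTerm; expTermₘ; expTermₘ-⋆)

partialSum-sum : ∀ {n} (f : Fin n → ℕ → ℂ) k →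
  partialSum (λ l → ℂ-Sum.sum λ j → f j l) k ≈ᶜ ℂ-Sum.sum λ j → partialSum (f j) k
partialSum-sum {n} f zero    = C.sym (ℂ-Sum.sum-replicate-zero n)
partialSum-sum     f (suc k) = C.trans (C.+-congʳ (partialSum-sum f k))
  (C.sym (ℂ-Sum.∑-distrib-+ (λ j → partialSum (f j) k) (λ j → f j k)))

partialSum-combination : ∀ {n} (f : Fin n → ℕ → ℂ) (l v : Vector ℂ n) →
  (∀ j → partialSum (f j) ⟶ᶜ l j) →
  partialSum (λ k → ℂ-Sum.sum λ j → f j k *ᶜ v j) ⟶ᶜ ℂ-Sum.sum λ j → l j *ᶜ v j
partialSum-combination f l v h = ⟶ᶜ-cong
  (λ k → C.sym (C.trans (partialSum-sum (λ j i → f j i *ᶜ v j) k)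
    (ℂ-Sum.sum-cong-≋ λ j → partialSum-*ʳ (f j) (v j) k)))
  C.refl (⟶ᶜ-sum λ j → ⟶ᶜ-* (h j) (⟶ᶜ-const (v j)))

expTermₘ-entries : ∀ {n} (A : Complex.Matrix n n) v i k →
  expTermₘ A v i k ≈ᶜ ℂ-Sum.sum λ j → ((A Complex.^ₘ k) i j /! k) *ᶜ v j
expTermₘ-entries A v i k = C.trans
  (ℂ-Sum.*-distribˡ-sum (1/! k) (λ j → (A Complex.^ₘ k) i j *ᶜ v j))
  (ℂ-Sum.sum-cong-≋ λ j → C.sym (C.*-assoc (1/! k) ((A Complex.^ₘ k) i j) (v j)))

expₘ-*ᵥ-correct : ∀ {n} (A : Complex.Matrix n n) v i →
  partialSum (expTermₘ A v i) ⟶ᶜ (expₘ A Complex.*ᵥ v) i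
expₘ-*ᵥ-correct A v i = ⟶ᶜ-cong
  (partialSum-cong λ k → C.sym (expTermₘ-entries A v i k)) C.refl
  (partialSum-combination (λ j k → (A Complex.^ₘ k) i j /! k) (expₘ A i) v (expₘ-correct A i))

-- Growth bounds are at hand for the entries of `B ^ₘ k`, so the Cauchy product is taken entry by
-- entry; linearity of `⋆` in its second factor then reassembles the vector.
expᶜ-*-expₘ-correct : ∀ {n} (B : Complex.Matrix n n) ζ v i →
  partialSum (expTerm ζ ⋆ expTermₘ B v i) ⟶ᶜ expᶜ ζ *ᶜ (expₘ B Complex.*ᵥ v) i
expᶜ-*-expₘ-correct {n} B ζ v i = ⟶ᶜ-cong
  {λ k → partialSum (λ l → ℂ-Sum.sum λ j → (expTerm ζ ⋆ entry j) l *ᶜ v j) k}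
  {partialSum (expTerm ζ ⋆ expTermₘ B v i)}
  {ℂ-Sum.sum λ j → expᶜ ζ *ᶜ expₘ B i j *ᶜ v j}
  {expᶜ ζ *ᶜ (expₘ B Complex.*ᵥ v) i}
  (partialSum-cong λ k → C.sym (expand k)) factor
  (partialSum-combination (λ j → expTerm ζ ⋆ entry j) (λ j → expᶜ ζ *ᶜ expₘ B i j) v entry-limit)
  where
  open Algebra.Properties.Semiring.Exp C.semiring using (_^_)
  module Z = ComplexExponential ζ
  module E = MatrixExponential B

  entry : Fin n → ℕ → ℂ
  entry j k = (B Complex.^ₘ k) i j /! k

  expand : ∀ k → (expTerm ζ ⋆ expTermₘ B v i) k ≈ᶜ ℂ-Sum.sum λ j → (expTerm ζ ⋆ entry j) k *ᶜ v j
  expand k = C.trans (ℂ-Convolution.⋆-cong {expTerm ζ} (λ _ → C.refl) (expTermₘ-entries B v i) k)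
    (C.trans (ℂ-Convolution.⋆-sum (expTerm ζ) (λ j l → entry j l *ᶜ v j) k)
      (ℂ-Sum.sum-cong-≋ λ j → ℂ-Convolution.⋆-*ʳ (v j) (expTerm ζ) (entry j) k))

  factor : ℂ-Sum.sum (λ j → expᶜ ζ *ᶜ expₘ B i j *ᶜ v j) ≈ᶜ expᶜ ζ *ᶜ (expₘ B Complex.*ᵥ v) i
  factor = C.trans (ℂ-Sum.sum-cong-≋ λ j → C.*-assoc (expᶜ ζ) (expₘ B i j) (v j))
    (C.sym (ℂ-Sum.*-distribˡ-sum (expᶜ ζ) (λ j → expₘ B i j *ᶜ v j)))

  entry-limit : ∀ j → partialSum (expTerm ζ ⋆ entry j) ⟶ᶜ expᶜ ζ *ᶜ expₘ B i j
  entry-limit j = cauchy-product {expTerm ζ} {entry j} {α = expᶜ ζ} {expₘ B i j}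
    (0<fromℕ-^ (4 ℕ.* (2 ℕ.* Z.K)) (suc (4 ℕ.* (2 ℕ.* Z.K))))
    (0<fromℕ-^ (2 ℕ.* E.q) (suc (2 ℕ.* E.q)))
    (λ k → /!-bounded 4 (2 ℕ.* Z.K) k {ζ ^ k} (Z.power-bounded k))
    (λ k → /!-bounded 2 E.q k {(B Complex.^ₘ k) i j} (E.power-bounded i j k))
    (expᶜ-correct ζ) (expₘ-correct B i j)

-- In each coordinate both sides are limits of the same partial sums, by `expTermₘ-⋆`.
expₘ-intertwines : ∀ {c m} (A : Complex.Matrix (c ℕ.+ m) (c ℕ.+ m)) (B : Complex.Matrix c c) ζ
  (W : Vector ℂ c → Set) → (∀ {y} → W y → W (B Complex.*ᵥ y)) →
  (∀ {y} → W y → A Complex.*ᵥ (y ++ Complex.0ᵥ {m}) Complex.≈ᵥ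
    (λ i → (B Complex.*ᵥ y ++ Complex.0ᵥ {m}) i +ᶜ ζ *ᶜ (y ++ Complex.0ᵥ {m}) i)) →
  ∀ {y} → W y →
  expₘ A Complex.*ᵥ (y ++ Complex.0ᵥ {m}) Complex.≈ᵥ
    expᶜ ζ Complex.·ᵥ ((expₘ B Complex.*ᵥ y) ++ Complex.0ᵥ {m})
expₘ-intertwines {c} {m} A B ζ W invariant intertwines {y} w i = ⟶ᶜ-unique
  {partialSum (expTermₘ A ŷ i)} {(expₘ A Complex.*ᵥ ŷ) i}
  {expᶜ ζ *ᶜ ((expₘ B Complex.*ᵥ y) ++ Complex.0ᵥ {m}) i}
  (expₘ-*ᵥ-correct A ŷ i)
  (⟶ᶜ-cong {partialSum (product i)} {partialSum (expTermₘ A ŷ i)}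
    {expᶜ ζ *ᶜ ((expₘ B Complex.*ᵥ y) ++ Complex.0ᵥ {m}) i}
    {expᶜ ζ *ᶜ ((expₘ B Complex.*ᵥ y) ++ Complex.0ᵥ {m}) i}
    (partialSum-cong same)
    C.refl
    (limit (splitAt c i)))
  where
  ŷ : Vector ℂ (c ℕ.+ m)
  ŷ = y ++ Complex.0ᵥ {m}

  product : Fin (c ℕ.+ m) → ℕ → ℂ
  product i k = ((λ j → (expTerm ζ ⋆ expTermₘ B y j) k) ++ Complex.0ᵥ {m}) i

  -- The case distinction is on p rather than by "with splitAt c i", which would
  -- normalise the exponentials in the goal.
  limit : ∀ p → partialSum (λ k → [ (λ j → (expTerm ζ ⋆ expTermₘ B y j) k) , Complex.0ᵥ ] p) ⟶ᶜ
            expᶜ ζ *ᶜ [ expₘ B Complex.*ᵥ y , Complex.0ᵥ ] p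
  limit (inj₁ j) = expᶜ-*-expₘ-correct B ζ y j
  limit (inj₂ _) = ⟶ᶜ-cong {λ _ → 0ᶜ} {partialSum λ _ → 0ᶜ} {0ᶜ} {expᶜ ζ *ᶜ 0ᶜ}
    (λ n → C.sym (partialSum-0ᶜ n)) (C.sym (C.zeroʳ (expᶜ ζ))) (⟶ᶜ-const 0ᶜ)

  same : ∀ k → product i k ≈ᶜ expTermₘ A ŷ i k
  same k = C.sym {expTermₘ A ŷ i k} {product i k} (expTermₘ-⋆ A B ζ W invariant intertwines k w i)

-- Real matrices of weighted graphs.

module ℝᶜ = CommutativeRing ℝ-commutativeRing
module ℝ-Sum = Algebra.Properties.Semiring.Sum ℝᶜ.semiring

fromℝ-cong : ∀ {x y} → x ≃ y → fromℝ x ≈ᶜ fromℝ y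
fromℝ-cong e = e , ≃-refl

fromℝ-+ : ∀ x y → fromℝ (x +ᴿ y) ≈ᶜ fromℝ x +ᶜ fromℝ y
fromℝ-+ x y = ≃-refl , ≡⇒≃ λ _ → ≡.refl

fromℝ-* : ∀ x y → fromℝ (x *ᴿ y) ≈ᶜ fromℝ x *ᶜ fromℝ y
fromℝ-* x y =
    ≡⇒≃ (λ n → solve 2 (λ x y → x :* y := x :* y :- con 0ℚ :* con 0ℚ) ≡.refl (approx x n) (approx y n))
  , ≡⇒≃ (λ n → solve 2 (λ x y → con 0ℚ := x :* con 0ℚ :+ con 0ℚ :* y) ≡.refl (approx x n) (approx y n))
  where open +-*-Solver

fromℝ-sum : ∀ {n} (v : Vector ℝ n) → fromℝ (ℝ-Sum.sum v) ≈ᶜ ℂ-Sum.sum (map fromℝ v)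
fromℝ-sum {zero}  v = C.refl
fromℝ-sum {suc n} v = C.trans (fromℝ-+ (v zero) (ℝ-Sum.sum (v ∘ suc))) (C.+-congˡ (fromℝ-sum (v ∘ suc)))

fromℝ-1ₘ : ∀ {n} (i j : Fin n) → fromℝ (Real.1ₘ i j) ≈ᶜ Complex.1ₘ i j
fromℝ-1ₘ i j with does (i Fin.≟ j)
... | true  = C.refl
... | false = C.refl

-- Brings the sum of the weights into S to the shape of a row sum over all vertices, comparable with
-- a row of the adjacency matrix.
sum-element : ∀ {n} (S : Subset n) (f : Vector ℝ n) →
  ℝ-Sum.sum (f ∘ element S) ≃ ℝ-Sum.sum λ v → if Vec.lookup S v then f v else 0ᴿ
sum-element Vec.[]          f = ≃-refl
sum-element (inside  ∷ S) f = ℝᶜ.+-congˡ (sum-element S (f ∘ suc))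
sum-element (outside ∷ S) f = ℝᶜ.trans (sum-element S (f ∘ suc)) (ℝᶜ.sym (ℝᶜ.+-identityˡ _))

module _ {n} (G : WeightedGraph n) where
  open WeightedGraph G

  adjacency-sym : ∀ u v → adjacency G u v ≃ adjacency G v u
  adjacency-sym u v with u ~? v | v ~? u
  ... | yes e | yes _ = ω-sym e
  ... | yes e | no ¬e = contradiction (~-sym e) ¬e
  ... | no ¬e | yes e = contradiction (~-sym e) ¬e
  ... | no _  | no _  = ≃-refl

  degree-sym : ∀ u v → degree G u v ≃ degree G v u
  degree-sym u v with u Fin.≟ v | v Fin.≟ u
  ... | yes ≡.refl | yes _ = ≃-refl
  ... | yes e      | no ¬e = contradiction (≡.sym e) ¬e
  ... | no ¬e      | yes e = contradiction (≡.sym e) ¬e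
  ... | no _       | no _  = ≃-refl

  matrix-sym : ∀ M u v → matrix M G u v ≃ matrix M G v u
  matrix-sym 𝐀 u v = adjacency-sym u v
  matrix-sym 𝐋 u v = ℝᶜ.+-cong (degree-sym u v) (ℝᶜ.-‿cong (adjacency-sym u v))
  matrix-sym 𝐐 u v = ℝᶜ.+-cong (degree-sym u v) (adjacency-sym u v)

  -- The eigenvalue equation for 1 prescribes row sums; symmetry turns them into the column sums
  -- required by `*ᵥ-balanced`.
  column-sum : ∀ M {μ} → (matrix M G Real.*ᵥ Real.1ᵥ) Real.≈ᵥ (μ Real.·ᵥ Real.1ᵥ) →
               ∀ v → ℝ-Sum.sum (λ u → matrix M G u v) ≃ μ
  column-sum M {μ} h v = ℝᶜ.trans
    (ℝ-Sum.sum-cong-≋ λ u → ℝᶜ.trans (matrix-sym M u v) (ℝᶜ.sym (ℝᶜ.*-identityʳ (matrix M G v u))))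
    (ℝᶜ.trans (h v) (ℝᶜ.*-identityʳ μ))

first-↑ˡ : ∀ {c} m (a : Fin c) → a ↑ˡ m ∈ first c m
first-↑ˡ {c} m a = Vec.lookup⇒[]= (a ↑ˡ m) (first c m)
  (≡.trans (Vec.lookup-++ˡ ⊤ ⊥ a) (Vec.lookup-replicate a inside))

≟-↑ˡ : ∀ {c} m (a b : Fin c) → does (a ↑ˡ m Fin.≟ b ↑ˡ m) ≡ does (a Fin.≟ b)
≟-↑ˡ m a b with a Fin.≟ b | a ↑ˡ m Fin.≟ b ↑ˡ m
... | yes _      | yes _ = ≡.refl
... | yes ≡.refl | no ¬e = contradiction ≡.refl ¬e
... | no ¬e      | yes e = contradiction (Fin.↑ˡ-injective m a b e) ¬e
... | no _       | no _  = ≡.refl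

≟-↑ʳ-↑ˡ : ∀ {c m} (p : Fin m) (a : Fin c) → does (c ↑ʳ p Fin.≟ a ↑ˡ m) ≡ false
≟-↑ʳ-↑ˡ {c} {m} p a with c ↑ʳ p Fin.≟ a ↑ˡ m
... | no _  = ≡.refl
... | yes e = contradiction
  (≡.trans (≡.sym (Fin.splitAt-↑ʳ c m p)) (≡.trans (≡.cong (splitAt c) e) (Fin.splitAt-↑ˡ c a m)))
  λ ()

-- The matrix of G(H) on the columns of the cluster.

module ClusterUnion {c m} (G : WeightedGraph (c ℕ.+ m)) (S : Subset (c ℕ.+ m))
  (cluster : IsCluster G (first c m) S) (H : WeightedGraph c)
  (u : Fin (c ℕ.+ m)) (u∈C : u ∈ first c m)
  where
  open IsCluster cluster
  open Union G H using (V; module G; module H; _~ᴴ_; _~ᴴ?_; ωᴴ)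

  Γ : WeightedGraph (c ℕ.+ m)
  Γ = G ⟨ H ⟩

  -- The common row of all vertices of C in the adjacency matrix of G.
  ωₛ : Vector ℝ (c ℕ.+ m)
  ωₛ v = if Vec.lookup S v then G.ω u v else 0ᴿ

  s : ℝ
  s = Real.1ᵥ Real.∙ weightsInto G S u

  sum-ωₛ : ℝ-Sum.sum ωₛ ≃ s
  sum-ωₛ = ℝᶜ.trans (ℝᶜ.sym (sum-element S (G.ω u)))
    (ℝ-Sum.sum-cong-≋ λ k → ℝᶜ.sym (ℝᶜ.*-identityˡ (G.ω u (element S k))))

  adjacency-cluster : ∀ {a} → a ∈ first c m → ∀ v → adjacency G a v ≃ ωₛ v
  adjacency-cluster {a} a∈C v with a G.~? v | Vec.lookup S v in eq
  ... | yes e | true  = uniform-ω (Vec.lookup⇒[]= v S eq) a∈C u∈C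
  ... | yes e | false = contradiction
    (≡.trans (≡.sym eq) (Vec.[]=⇒lookup (Equivalence.to (neighbourhood a∈C v) e))) λ ()
  ... | no ¬e | true  = contradiction (Equivalence.from (neighbourhood a∈C v) (Vec.lookup⇒[]= v S eq)) ¬e
  ... | no _  | false = ≃-refl

  adjacencyᴴ : V → V → ℝ
  adjacencyᴴ (inj₁ a) (inj₁ b) = adjacency H a b
  adjacencyᴴ _        _        = 0ᴿ

  -- An edge of both graphs would keep only its weight from H, and the sum formula would fail;
  -- independence of C excludes this case.
  adjacency-⊎ : ∀ {e} {E : Set e} (d : Dec E) p q w →
    (∀ {a b} → p ≡ inj₁ a → q ≡ inj₁ b → ¬ E) →
    (if does (d ⊎-dec (p ~ᴴ? q)) then ωᴴ p q w else 0ᴿ) ≃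
    (if does d then w else 0ᴿ) +ᴿ adjacencyᴴ p q
  adjacency-⊎ (yes e) (inj₁ a) (inj₁ b) w i = contradiction e (i ≡.refl ≡.refl)
  adjacency-⊎ (no _)  (inj₁ a) (inj₁ b) w i with a H.~? b
  ... | yes _ = ℝᶜ.sym (ℝᶜ.+-identityˡ (H.ω a b))
  ... | no _  = ℝᶜ.sym (ℝᶜ.+-identityˡ 0ᴿ)
  adjacency-⊎ (yes _) (inj₁ _) (inj₂ _) w i = ℝᶜ.sym (ℝᶜ.+-identityʳ w)
  adjacency-⊎ (no _)  (inj₁ _) (inj₂ _) w i = ℝᶜ.sym (ℝᶜ.+-identityʳ 0ᴿ)
  adjacency-⊎ (yes _) (inj₂ _) _        w i = ℝᶜ.sym (ℝᶜ.+-identityʳ w)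
  adjacency-⊎ (no _)  (inj₂ _) _        w i = ℝᶜ.sym (ℝᶜ.+-identityʳ 0ᴿ)

  ∈first : ∀ {v a} → splitAt c v ≡ inj₁ a → v ∈ first c m
  ∈first {a = a} e = ≡.subst (_∈ first c m) (Fin.splitAt⁻¹-↑ˡ e) (first-↑ˡ m a)

  adjacency-Γ : ∀ v w → adjacency Γ v w ≃ adjacency G v w +ᴿ adjacencyᴴ (splitAt c v) (splitAt c w)
  adjacency-Γ v w = adjacency-⊎ (v G.~? w) (splitAt c v) (splitAt c w) (G.ω v w)
    λ e f → independent (∈first e) (∈first f)

  adjacency-Γ-CC : ∀ a b → adjacency Γ (a ↑ˡ m) (b ↑ˡ m) ≃ adjacency H a b
  adjacency-Γ-CC a b = ℝᶜ.trans (adjacency-Γ (a ↑ˡ m) (b ↑ˡ m)) (ℝᶜ.trans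
    (ℝᶜ.+-cong no-edge (ℝᶜ.reflexive (≡.cong₂ adjacencyᴴ (Fin.splitAt-↑ˡ c a m) (Fin.splitAt-↑ˡ c b m))))
    (ℝᶜ.+-identityˡ (adjacency H a b)))
    where
    no-edge : adjacency G (a ↑ˡ m) (b ↑ˡ m) ≃ 0ᴿ
    no-edge with (a ↑ˡ m) G.~? (b ↑ˡ m)
    ... | yes e = contradiction e (independent (first-↑ˡ m a) (first-↑ˡ m b))
    ... | no _  = ≃-refl

  adjacency-Γ-outside : ∀ p b → adjacency Γ (c ↑ʳ p) (b ↑ˡ m) ≃ ωₛ (c ↑ʳ p)
  adjacency-Γ-outside p b = ℝᶜ.trans (adjacency-Γ (c ↑ʳ p) (b ↑ˡ m)) (ℝᶜ.trans
    (ℝᶜ.+-cong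
      (ℝᶜ.trans (adjacency-sym G (c ↑ʳ p) (b ↑ˡ m)) (adjacency-cluster (first-↑ˡ m b) (c ↑ʳ p)))
      (ℝᶜ.reflexive (≡.cong (λ q → adjacencyᴴ q (splitAt c (b ↑ˡ m))) (Fin.splitAt-↑ʳ c m p))))
    (ℝᶜ.+-identityʳ _))

  degree-Γ : ∀ a → ℝ-Sum.sum (adjacency Γ (a ↑ˡ m)) ≃ ℝ-Sum.sum (adjacency H a) +ᴿ s
  degree-Γ a = ℝᶜ.trans (ℝ-Sum.sum-cong-≋ (adjacency-Γ (a ↑ˡ m))) (ℝᶜ.trans
    (ℝ-Sum.∑-distrib-+ (adjacency G (a ↑ˡ m)) inH)
    (ℝᶜ.trans (ℝᶜ.+-cong fromG fromH) (ℝᶜ.+-comm s _)))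
    where
    open MatrixAlgebra ℝ-commutativeRing using (sum-++; sum-zero)
    inH : Vector ℝ (c ℕ.+ m)
    inH v = adjacencyᴴ (splitAt c (a ↑ˡ m)) (splitAt c v)
    fromG : ℝ-Sum.sum (adjacency G (a ↑ˡ m)) ≃ s
    fromG = ℝᶜ.trans (ℝ-Sum.sum-cong-≋ (adjacency-cluster (first-↑ˡ m a))) sum-ωₛ
    fromH : ℝ-Sum.sum inH ≃ ℝ-Sum.sum (adjacency H a)
    fromH = ℝᶜ.trans (sum-++ {c} {m} inH) (ℝᶜ.trans
      (ℝᶜ.+-cong
        (ℝ-Sum.sum-cong-≋ λ b → ℝᶜ.reflexive
          (≡.cong₂ adjacencyᴴ (Fin.splitAt-↑ˡ c a m) (Fin.splitAt-↑ˡ c b m)))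
        (sum-zero λ p → ℝᶜ.reflexive
          (≡.cong₂ adjacencyᴴ (Fin.splitAt-↑ˡ c a m) (Fin.splitAt-↑ʳ c m p))))
      (ℝᶜ.+-identityʳ _))

  degree-Γ-CC : ∀ a b → degree Γ (a ↑ˡ m) (b ↑ˡ m) ≃ degree H a b +ᴿ s *ᴿ Real.1ₘ a b
  degree-Γ-CC a b = ℝᶜ.trans
    (ℝᶜ.reflexive (≡.cong (λ d → if d then ℝ-Sum.sum (adjacency Γ (a ↑ˡ m)) else 0ᴿ) (≟-↑ˡ m a b)))
    case
    where
    case : (if does (a Fin.≟ b) then ℝ-Sum.sum (adjacency Γ (a ↑ˡ m)) else 0ᴿ) ≃
           degree H a b +ᴿ s *ᴿ Real.1ₘ a b
    case with does (a Fin.≟ b)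
    ... | true  = ℝᶜ.trans (degree-Γ a) (ℝᶜ.+-congˡ (ℝᶜ.sym (ℝᶜ.*-identityʳ s)))
    ... | false = ℝᶜ.sym (ℝᶜ.trans (ℝᶜ.+-identityˡ _) (ℝᶜ.zeroʳ s))

  degree-Γ-outside : ∀ p b → degree Γ (c ↑ʳ p) (b ↑ˡ m) ≃ 0ᴿ
  degree-Γ-outside p b = ℝᶜ.reflexive
    (≡.cong (λ d → if d then ℝ-Sum.sum (adjacency Γ (c ↑ʳ p)) else 0ᴿ) (≟-↑ʳ-↑ˡ p b))

  regroup : ∀ d i x → d +ᴿ s *ᴿ i +ᴿ x ≃ d +ᴿ x +ᴿ 1ᴿ *ᴿ s *ᴿ i
  regroup d i x = ≡⇒≃ λ n → solve 4
    (λ d s i x → d :+ s :* i :+ x := d :+ x :+ con 1ℚ :* s :* i) ≡.refl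
    (approx d n) (approx s n) (approx i n) (approx x n)
    where open +-*-Solver

  -- On C the adjacency entries are those of H, while every degree grows by `s`. The correction is
  -- thus `s` times the identity when degrees enter and zero for `𝐀`, which is the origin of `δ`.
  matrix-Γ-CC : ∀ M a b → matrix M Γ (a ↑ˡ m) (b ↑ˡ m) ≃ matrix M H a b +ᴿ δ M *ᴿ s *ᴿ Real.1ₘ a b
  matrix-Γ-CC 𝐀 a b = ℝᶜ.trans (adjacency-Γ-CC a b) (ℝᶜ.sym (ℝᶜ.trans
    (ℝᶜ.+-congˡ (ℝᶜ.trans (ℝᶜ.*-congʳ (ℝᶜ.zeroˡ s)) (ℝᶜ.zeroˡ _)))
    (ℝᶜ.+-identityʳ _)))
  matrix-Γ-CC 𝐋 a b = ℝᶜ.trans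
    (ℝᶜ.+-cong (degree-Γ-CC a b) (ℝᶜ.-‿cong (adjacency-Γ-CC a b)))
    (regroup (degree H a b) (Real.1ₘ a b) (-ᴿ adjacency H a b))
  matrix-Γ-CC 𝐐 a b = ℝᶜ.trans
    (ℝᶜ.+-cong (degree-Γ-CC a b) (adjacency-Γ-CC a b))
    (regroup (degree H a b) (Real.1ₘ a b) (adjacency H a b))

  -- The `0ᴿ` is the off-diagonal entry of the degree matrix, left in place so that congruence of
  -- `_+ᴿ_` applies directly.
  lowerRow : MatrixKind → Fin m → ℝ
  lowerRow 𝐀 p = ωₛ (c ↑ʳ p)
  lowerRow 𝐋 p = 0ᴿ -ᴿ ωₛ (c ↑ʳ p)
  lowerRow 𝐐 p = 0ᴿ +ᴿ ωₛ (c ↑ʳ p)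

  matrix-Γ-outside : ∀ M p b → matrix M Γ (c ↑ʳ p) (b ↑ˡ m) ≃ lowerRow M p
  matrix-Γ-outside 𝐀 p b = adjacency-Γ-outside p b
  matrix-Γ-outside 𝐋 p b = ℝᶜ.+-cong (degree-Γ-outside p b) (ℝᶜ.-‿cong (adjacency-Γ-outside p b))
  matrix-Γ-outside 𝐐 p b = ℝᶜ.+-cong (degree-Γ-outside p b) (adjacency-Γ-outside p b)

-- Transfer to the transition matrices.

-- Written with LinearAlgebra rather than with its instance Complex because this is
-- the form to which U unfolds: U≡expₘ is then checked without comparing limits.
generator : MatrixKind → ∀ {n} → WeightedGraph n → ℝ → Complex.Matrix n n
generator M G t = LinearAlgebra._·ₘ_ ℂ-commutativeRing (𝕚 *ᶜ fromℝ t) λ v w → fromℝ (matrix M G v w)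

U≡expₘ : ∀ M {n} (G : WeightedGraph n) t →
  U M G t ≡ expₘ (LinearAlgebra._·ₘ_ ℂ-commutativeRing (𝕚 *ᶜ fromℝ t) λ v w → fromℝ (matrix M G v w))
U≡expₘ M G t = ≡.refl

U≡expₘ-generator : ∀ M {n} (G : WeightedGraph n) t → U M G t ≡ expₘ (generator M G t)
U≡expₘ-generator M G t = ≡.trans (U≡expₘ M G t) (≡.cong expₘ ≡.refl)

U-intertwines : ∀ {c m} M (Γ : WeightedGraph (c ℕ.+ m)) (H : WeightedGraph c) t ζ
  (W : Vector ℂ c → Set) → (∀ {y} → W y → W (generator M H t Complex.*ᵥ y)) →
  (∀ {y} → W y → generator M Γ t Complex.*ᵥ (y ++ Complex.0ᵥ {m}) Complex.≈ᵥ
    (λ i → (generator M H t Complex.*ᵥ y ++ Complex.0ᵥ {m}) i +ᶜ ζ *ᶜ (y ++ Complex.0ᵥ {m}) i)) →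
  ∀ {y} → W y →
  U M Γ t Complex.*ᵥ (y ++ Complex.0ᵥ {m}) Complex.≈ᵥ
    expᶜ ζ Complex.·ᵥ ((U M H t Complex.*ᵥ y) ++ Complex.0ᵥ {m})
U-intertwines {c} {m} M Γ H t ζ W invariant intertwines {y} w = ≡.subst₂
  (λ E F → E Complex.*ᵥ (y ++ Complex.0ᵥ {m}) Complex.≈ᵥ
    expᶜ ζ Complex.·ᵥ ((F Complex.*ᵥ y) ++ Complex.0ᵥ {m}))
  (≡.sym (U≡expₘ-generator M Γ t)) (≡.sym (U≡expₘ-generator M H t))
  (expₘ-intertwines (generator M Γ t) (generator M H t) ζ W invariant intertwines w)

-- ζ and the other data are implicit and the conclusion is entrywise, so that ζ is
-- read off the goal before the hypotheses are checked: otherwise two forms of ζ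
-- would be compared under expᶜ, which makes Agda unfold the limits.
U-intertwines-entry : ∀ {c m M} {Γ : WeightedGraph (c ℕ.+ m)} {H : WeightedGraph c} {t ζ}
  {W : Vector ℂ c → Set} {y : Vector ℂ c} {i : Fin (c ℕ.+ m)} →
  (∀ {y} → W y → W (generator M H t Complex.*ᵥ y)) →
  (∀ {y} → W y → generator M Γ t Complex.*ᵥ (y ++ Complex.0ᵥ {m}) Complex.≈ᵥ
    (λ i → (generator M H t Complex.*ᵥ y ++ Complex.0ᵥ {m}) i +ᶜ ζ *ᶜ (y ++ Complex.0ᵥ {m}) i)) →
  W y →
  (U M Γ t Complex.*ᵥ (y ++ Complex.0ᵥ {m})) i ≈ᶜ
    (expᶜ ζ Complex.·ᵥ ((U M H t Complex.*ᵥ y) ++ Complex.0ᵥ {m})) i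
U-intertwines-entry {M = M} {Γ} {H} {t} {ζ} {W} {i = i} invariant intertwines w =
  U-intertwines M Γ H t ζ W invariant intertwines w i

open import Data.Nat.Base using (_+_)

lemma3 : ∀ {c m : ℕ} (M : MatrixKind)
    (G : WeightedGraph (c + m)) (S : Subset (c + m)) →
    Connected G →
    IsCluster G (first c m) S →
    (H : WeightedGraph c) →
    Real.IsEigenvector (matrix M H) Real.1ᵥ →
    (x : Vector ℝ c) →
    Real.1ᵥ Real.∙ x ≃ 0ᴿ →
    (t : ℝ) →
    (u : Fin (c + m)) → u ∈ first c m →
    let z = weightsInto G S u
        x′ = map fromℝ x
    in
    U M (G ⟨ H ⟩) t Complex.*ᵥ (x′ ++ Complex.0ᵥ {m})
      Complex.≈ᵥ
    expᶜ (𝕚 *ᶜ fromℝ (δ M *ᴿ t *ᴿ (Real.1ᵥ Real.∙ z))) Complex.·ᵥ ((U M H t Complex.*ᵥ x′) ++ Complex.0ᵥ {m})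
lemma3 {c} {m} M G S _ cluster H (_ , μ , row-sums) x balanced t u u∈C i =
  U-intertwines-entry {M = M} {G ⟨ H ⟩} {H} {t} {W = Balanced ℂ-commutativeRing} {map fromℝ x} {i}
    -- `B` is it times the matrix of H, so its column sums are itμ.
    (*ᵥ-balanced ℂ-commutativeRing B (θ *ᶜ fromℝ μ) columns)
    (block-intertwines ℂ-commutativeRing A B ζ (λ p → θ *ᶜ fromℝ (lowerRow M p))
      upper (λ p b → C.*-congˡ {θ} (fromℝ-cong (matrix-Γ-outside M p b))))
    (C.trans (C.sym (fromℝ-sum x)) (fromℝ-cong
      (ℝᶜ.trans (ℝ-Sum.sum-cong-≋ λ i → ℝᶜ.sym (ℝᶜ.*-identityˡ (x i))) balanced)))
  where
  open ClusterUnion G S cluster H u u∈C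

  θ ζ : ℂ
  θ = 𝕚 *ᶜ fromℝ t
  -- The factors stand in the order of the theorem, whereas the matrix entries produce
  -- `θ *ᶜ fromℝ (δ M *ᴿ s)`; `ζ-θ` reconciles the two.
  ζ = 𝕚 *ᶜ fromℝ (δ M *ᴿ t *ᴿ s)

  A : Complex.Matrix (c + m) (c + m)
  A = generator M Γ t

  B : Complex.Matrix c c
  B = generator M H t

  columns : ∀ b → ℂ-Sum.sum (λ a → B a b) ≈ᶜ θ *ᶜ fromℝ μ
  columns b = C.trans (C.sym (ℂ-Sum.*-distribˡ-sum θ (λ a → fromℝ (matrix M H a b))))
    (C.*-congˡ {θ} (C.trans (C.sym (fromℝ-sum (λ a → matrix M H a b)))
      (fromℝ-cong (column-sum H M row-sums b))))

  ζ-θ : θ *ᶜ fromℝ (δ M *ᴿ s) ≈ᶜ ζ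
  ζ-θ = C.trans (C.*-assoc 𝕚 (fromℝ t) (fromℝ (δ M *ᴿ s))) (C.*-congˡ {𝕚} (C.trans
    (C.sym (fromℝ-* t (δ M *ᴿ s)))
    (fromℝ-cong (ℝᶜ.trans (ℝᶜ.sym (ℝᶜ.*-assoc t (δ M) s)) (ℝᶜ.*-congʳ (ℝᶜ.*-comm t (δ M)))))))

  upper : ∀ a b → A (a ↑ˡ m) (b ↑ˡ m) ≈ᶜ B a b +ᶜ ζ *ᶜ Complex.1ₘ a b
  upper a b = begin
    θ *ᶜ fromℝ (matrix M Γ (a ↑ˡ m) (b ↑ˡ m))
      ≈⟨ C.*-congˡ {θ} (C.trans (fromℝ-cong (matrix-Γ-CC M a b))
           (fromℝ-+ (matrix M H a b) (δ M *ᴿ s *ᴿ Real.1ₘ a b))) ⟩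
    θ *ᶜ (fromℝ (matrix M H a b) +ᶜ fromℝ (δ M *ᴿ s *ᴿ Real.1ₘ a b))
      ≈⟨ C.distribˡ θ (fromℝ (matrix M H a b)) (fromℝ (δ M *ᴿ s *ᴿ Real.1ₘ a b)) ⟩
    B a b +ᶜ θ *ᶜ fromℝ (δ M *ᴿ s *ᴿ Real.1ₘ a b)
      ≈⟨ C.+-congˡ {B a b} (C.*-congˡ {θ} (C.trans (fromℝ-* (δ M *ᴿ s) (Real.1ₘ a b))
           (C.*-congˡ {fromℝ (δ M *ᴿ s)} (fromℝ-1ₘ a b)))) ⟩
    B a b +ᶜ θ *ᶜ (fromℝ (δ M *ᴿ s) *ᶜ Complex.1ₘ a b)
      ≈⟨ C.+-congˡ {B a b} (C.trans (C.sym (C.*-assoc θ (fromℝ (δ M *ᴿ s)) (Complex.1ₘ a b)))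
           (C.*-congʳ {Complex.1ₘ a b} ζ-θ)) ⟩
    B a b +ᶜ ζ *ᶜ Complex.1ₘ a b ∎
    where open Relation.Binary.Reasoning.Setoid ℂ-setoid
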